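{- Let $\Delta=\{x,y,z_1,z_2\}$ be an alphabet of four distinct letters and, for a positive integer $t$, let $K_t=z_1(x^*y)^{t-1}x^*z_2\subseteq\Delta^*$. There exist positive integers $k$ and $t$ such that there is no algorithm to decide whether a given monoid morphism $\mu\colon\Delta^*\to\mathbb{Z}^{k\times k}_{\rm uptr}$ is injective on $K_t$.
   Context: $\mathbb{Z}^{k\times k}_{\rm uptr}$ denotes the monoid (under matrix multiplication) of upper-triangular $k\times k$ matrices with integer entries. A morphism $\mu$ is injective on a language $L$ if for all $w_1,w_2\in L$, $\mu(w_1)=\mu(w_2)$ implies $w_1=w_2$. -}

module Defs where

open import Data.Nat using (ℕ; zero; suc; _+_; _*_; _∸_; _<_; _≤_)
open import Data.Integer as ℤ using (ℤ; +_; -[1+_])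
open import Data.Fin using (Fin; toℕ)
open import Data.Vec using (Vec; []; _∷_; lookup; tabulate; concat; foldr)
open import Data.List using (List; []; _∷_; _++_; replicate)
open import Data.Product using (Σ; _×_; _,_; proj₁)
open import Relation.Binary.PropositionalEquality using (_≡_)
open import Relation.Nullary using (¬_)

data Δ : Set where
  x y z₁ z₂ : Δ

letter : Fin 4 → Δ
letter Fin.zero = x
letter (Fin.suc Fin.zero) = y
letter (Fin.suc (Fin.suc Fin.zero)) = z₁
letter (Fin.suc (Fin.suc (Fin.suc Fin.zero))) = z₂

blocks : ∀ {r} → Vec ℕ r → List Δ
blocks [] = []
blocks (n ∷ ns) = replicate n x ++ (y ∷ blocks ns)

InK : ℕ → List Δ → Set
InK t w = Σ (Vec ℕ (t ∸ 1)) λ ns → Σ ℕ λ m →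
  w ≡ z₁ ∷ (blocks ns ++ (replicate m x ++ (z₂ ∷ [])))

Mat : ℕ → Set
Mat k = Vec (Vec ℤ k) k

entry : ∀ {k} → Mat k → Fin k → Fin k → ℤ
entry M i j = lookup (lookup M i) j

sumℤ : ∀ {n} → Vec ℤ n → ℤ
sumℤ = foldr _ ℤ._+_ (+ 0)

_⊗_ : ∀ {k} → Mat k → Mat k → Mat k
A ⊗ B = tabulate λ i → tabulate λ j → sumℤ (tabulate λ l → entry A i l ℤ.* entry B l j)

idMat : ∀ k → Mat k
idMat k = tabulate λ i → tabulate λ j → Data.Fin._≟_ i j |> λ d → δ d
  where
  open import Relation.Nullary using (Dec; yes; no)
  open import Function using (_|>_)
  δ : ∀ {P : Set} → Dec P → ℤ
  δ (yes _) = + 1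
  δ (no _) = + 0

IsUpper : ∀ {k} → Mat k → Set
IsUpper M = ∀ i j → toℕ j < toℕ i → entry M i j ≡ + 0

UT : ℕ → Set
UT k = Σ (Mat k) IsUpper

-- A monoid morphism μ : Δ* → Z^{k×k}_uptr is determined by (and given by)
-- the images of the letters; its value on a word is the product of those images.
Morphism : ℕ → Set
Morphism k = Δ → UT k

apply : ∀ {k} → Morphism k → List Δ → Mat k
apply {k} μ [] = idMat k
apply μ (a ∷ w) = proj₁ (μ a) ⊗ apply μ w

InjectiveOnK : ∀ {k} → ℕ → Morphism k → Set
InjectiveOnK t μ = ∀ w₁ w₂ → InK t w₁ → InK t w₂ → apply μ w₁ ≡ apply μ w₂ → w₁ ≡ w₂

data PR : ℕ → Set where
  Zf : ∀ {n} → PR n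
  Sf : PR 1
  Pf : ∀ {n} → Fin n → PR n
  Cf : ∀ {n m} → PR m → Vec (PR n) m → PR n
  Rf : ∀ {n} → PR n → PR (suc (suc n)) → PR (suc n)
  Mf : ∀ {n} → PR (suc n) → PR n

data Eval : ∀ {n} → PR n → Vec ℕ n → ℕ → Set
data EvalAll : ∀ {n m} → Vec (PR n) m → Vec ℕ n → Vec ℕ m → Set

data Eval where
  eZ : ∀ {n} {xs : Vec ℕ n} → Eval Zf xs 0
  eS : ∀ {a} → Eval Sf (a ∷ []) (suc a)
  eP : ∀ {n} {i : Fin n} {xs} → Eval (Pf i) xs (lookup xs i)
  eC : ∀ {n m} {f : PR m} {gs : Vec (PR n) m} {xs ys r} →
       EvalAll gs xs ys → Eval f ys r → Eval (Cf f gs) xs r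
  eR0 : ∀ {n} {f : PR n} {g xs r} → Eval f xs r → Eval (Rf f g) (0 ∷ xs) r
  eRS : ∀ {n} {f : PR n} {g a xs r r′} →
        Eval (Rf f g) (a ∷ xs) r → Eval g (a ∷ r ∷ xs) r′ →
        Eval (Rf f g) (suc a ∷ xs) r′
  eM : ∀ {n} {f : PR (suc n)} {xs a} →
       Eval f (a ∷ xs) 0 →
       (∀ b → b < a → Σ ℕ λ r → Eval f (b ∷ xs) (suc r)) →
       Eval (Mf f) xs a

data EvalAll where
  [] : ∀ {n} {xs : Vec ℕ n} → EvalAll [] xs []
  _∷_ : ∀ {n m} {g : PR n} {gs : Vec (PR n) m} {xs r rs} →
        Eval g xs r → EvalAll gs xs rs → EvalAll (g ∷ gs) xs (r ∷ rs)

-- Encoding of a morphism as an input: the 4·k·k entries of the letter images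
-- (letters in the order x, y, z₁, z₂; rows then columns), each integer coded
-- in ℕ by the standard zig-zag bijection.

codeℤ : ℤ → ℕ
codeℤ (+ n) = 2 * n
codeℤ -[1+ n ] = suc (2 * n)

code : ∀ {k} → Morphism k → Vec ℕ (4 * (k * k))
code μ = concat (tabulate λ a → concat (tabulate λ i → tabulate λ j →
  codeℤ (entry (proj₁ (μ (letter a))) i j)))

DecidesInjectivity : (k t : ℕ) → PR (4 * (k * k)) → Set
DecidesInjectivity k t e = (μ : Morphism k) →
  (InjectiveOnK t μ → Eval e (code μ) 1) × (¬ InjectiveOnK t μ → Eval e (code μ) 0)

{-# OPTIONS --safe #-}
module Submission where

-- A word of K_t is determined by its t exponents w and s.  Upper triangular
-- matrices realise all sums of products of the factors n and 2 ^ n of these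
-- exponents, so a system of equations between such sums in the unknowns w
-- yields a morphism with the value (w , s * (lhs - rhs) , ...), which is
-- injective on K_t iff the system has no solution.  It therefore suffices to
-- describe acceptance of partial recursive programs by one such system, with
-- the program as a parameter.  Programs run on a universal machine whose steps
-- are given by 14 rewriting rules on nested pairs, coded as numbers by a
-- polynomial.  A run is a sequence of numbers, that is a list of digits in a
-- large base 2 ^ b; a polynomial relation can be imposed on all digits at once,
-- since digits are controlled by the parity of binomial coefficients (Lucas)
-- and digitwise products are coefficients of products in larger bases.

open import Defs
open import Data.Nat using (ℕ; zero; suc; _+_; _*_; _^_; _∸_; _≤_; _<_; _⊔_; z≤n; s≤s; _≡ᵇ_; >-nonZero)
open import Data.Nat.Properties
open import Data.Nat.Tactic.RingSolver using (solve-∀)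
open import Data.Integer as ℤ using (ℤ)
import Data.Integer.Properties as ℤ
open import Data.Integer.Tactic.RingSolver using () renaming (solve-∀ to solveℤ-∀)
open import Data.Bool using (Bool; true; false; not; _xor_; _∨_) renaming (_∧_ to _&_)
open import Data.Fin as Fin using (Fin; toℕ; _↑ˡ_; _↑ʳ_; splitAt) renaming (zero to fzero; suc to fsuc)
open import Data.Fin.Properties using (↑ˡ-injective; ↑ʳ-injective; splitAt-↑ˡ; splitAt-↑ʳ)
  renaming (suc-injective to fsuc-injective)
open import Data.Vec as Vec using (Vec; []; _∷_; lookup; tabulate; allFin; concat; _[_]≔_)
open import Data.Vec.Properties using (lookup-++ˡ; lookup-++ʳ; lookup∘tabulate; tabulate-cong;
  tabulate∘lookup; lookup-replicate; lookup∘update′)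
open import Data.List as List using (List; []; _∷_; _++_; replicate)
open import Data.List.Properties using (++-cancelˡ; ∷-injectiveʳ)
open import Data.List.Relation.Unary.All as All using (All; []; _∷_)
import Data.List.Relation.Unary.All.Properties as All
open import Data.Product using (Σ; _×_; _,_; proj₁; proj₂)
open import Data.Sum using (_⊎_; inj₁; inj₂)
open import Data.Unit using (⊤; tt)
open import Data.Empty using (⊥; ⊥-elim)
open import Function using (_∘_)
open import Relation.Binary.Construct.Closure.ReflexiveTransitive using (Star; ε; _◅_; _◅◅_)
open import Relation.Binary.Definitions using (Tri; tri<; tri≈; tri>)
open import Relation.Binary.PropositionalEquality
open import Relation.Nullary using (¬_; Dec; yes; no)

-- The dimension `k` and the length `t` must not depend on the instance, so the number of unknowns
-- is fixed while runs are arbitrarily long. Hence "every step is legal", a universal quantifier of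
-- unbounded range, has to be absorbed into the values of finitely many unknowns; this is the task
-- of the digits. Powers of 2 are available from the start because a state may double its value at
-- each `x`. Two restrictions shape the rest. A word is read once, so a monomial takes one factor
-- from each exponent, and products are formed of distinct unknowns only. Imposing a relation on all
-- digits turns a polynomial relation into an exponential one and cannot be iterated; therefore
-- formulas come in two kinds, and the step relation, pairing included, has to be polynomial. The
-- diagonal argument replaces a reduction from halting, so it needs a simulation only of programs
-- that do return a value.

Env : ℕ → Set
Env zero = ⊤
Env (suc n) = ℕ × Env n

data Kind : Set where
  alg exp : Kind

-- Terms and formulas are indexed by the function and the relation that they
-- denote, so that weakening and substitution hold by computation.
data Tm : Kind → ∀ {n} → (Env n → ℕ) → Set where
  top  : ∀ {k n} → Tm k {suc n} proj₁
  pop  : ∀ {k n} {f : Env n → ℕ} → Tm k f → Tm k {suc n} (λ ρ → f (proj₂ ρ))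
  con  : ∀ {k n} c → Tm k {n} (λ _ → c)
  _⊕_  : ∀ {k n} {f g : Env n → ℕ} → Tm k f → Tm k g → Tm k (λ ρ → f ρ + g ρ)
  _⊛_  : ∀ {k n} {f g : Env n → ℕ} → Tm k f → Tm k g → Tm k (λ ρ → f ρ * g ρ)
  two^ : ∀ {n} {f : Env n → ℕ} → Tm exp f → Tm exp (λ ρ → 2 ^ f ρ)

infixl 6 _⊕_
infixl 7 _⊛_
infix 4 _≐_
infixr 3 _∧_

data Dio : Kind → ∀ {n} → (Env n → Set) → Set₁ where
  _≐_ : ∀ {k n} {f g : Env n → ℕ} → Tm k f → Tm k g → Dio k (λ ρ → f ρ ≡ g ρ)
  _∧_ : ∀ {k n} {P Q : Env n → Set} → Dio k P → Dio k Q → Dio k (λ ρ → P ρ × Q ρ)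
  ex  : ∀ {k n} {P : Env (suc n) → Set} → Dio k P → Dio k (λ ρ → Σ ℕ λ v → P (v , ρ))
  -- The syntax has neither order nor disjunction; such relations enter here, with a proof of
  -- equivalence.
  iff : ∀ {k n} {P Q : Env n → Set} →
        (∀ ρ → P ρ → Q ρ) → (∀ ρ → Q ρ → P ρ) → Dio k P → Dio k Q

-- Systems of atomic equations.

data Atom (N : ℕ) : Set where
  eq       : Fin N → Fin N → Atom N
  is       : Fin N → ℕ → Atom N
  -- A product becomes one monomial with one factor per block of the word, so a square has to be
  -- written with a second unknown equated to the first.
  sum prod : (i j k : Fin N) → i ≢ j → Atom N
  pow      : Fin N → Fin N → Atom N

Holds : ∀ {N} → Vec ℕ N → Atom N → Set
Holds w (eq i j) = lookup w i ≡ lookup w j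
Holds w (is i c) = lookup w i ≡ c
Holds w (sum i j k _) = lookup w i + lookup w j ≡ lookup w k
Holds w (prod i j k _) = lookup w i * lookup w j ≡ lookup w k
Holds w (pow i j) = 2 ^ lookup w i ≡ lookup w j

Inj : ∀ {N M} → (Fin N → Fin M) → Set
Inj r = ∀ {i j} → r i ≡ r j → i ≡ j

ren : ∀ {N M} (r : Fin N → Fin M) → Inj r → Atom N → Atom M
ren r inj (eq i j) = eq (r i) (r j)
ren r inj (is i c) = is (r i) c
ren r inj (sum i j k ne) = sum (r i) (r j) (r k) (λ e → ne (inj e))
ren r inj (prod i j k ne) = prod (r i) (r j) (r k) (λ e → ne (inj e))
ren r inj (pow i j) = pow (r i) (r j)

module _ {N M : ℕ} {r : Fin N → Fin M} (inj : Inj r) {w : Vec ℕ N} {w′ : Vec ℕ M}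
         (agree : ∀ i → lookup w′ (r i) ≡ lookup w i) where

  ren⁺ : ∀ a → Holds w a → Holds w′ (ren r inj a)
  ren⁺ (eq i j) h rewrite agree i | agree j = h
  ren⁺ (is i c) h rewrite agree i = h
  ren⁺ (sum i j k _) h rewrite agree i | agree j | agree k = h
  ren⁺ (prod i j k _) h rewrite agree i | agree j | agree k = h
  ren⁺ (pow i j) h rewrite agree i | agree j = h

  ren⁻ : ∀ a → Holds w′ (ren r inj a) → Holds w a
  ren⁻ (eq i j) h rewrite agree i | agree j = h
  ren⁻ (is i c) h rewrite agree i = h
  ren⁻ (sum i j k _) h rewrite agree i | agree j | agree k = h
  ren⁻ (prod i j k _) h rewrite agree i | agree j | agree k = h
  ren⁻ (pow i j) h rewrite agree i | agree j = h

  rens⁺ : ∀ as → All (Holds w) as → All (Holds w′) (List.map (ren r inj) as)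
  rens⁺ as hs = All.map⁺ (All.map (λ {a} → ren⁺ a) hs)

  rens⁻ : ∀ as → All (Holds w′) (List.map (ren r inj) as) → All (Holds w) as
  rens⁻ as hs = All.map (λ {a} → ren⁻ a) (All.map⁻ hs)

look : ∀ {N n} → Vec ℕ N → Vec (Fin N) n → Env n
look w [] = tt
look w (i ∷ σ) = lookup w i , look w σ

look-map : ∀ {N M n} {r : Fin N → Fin M} {w : Vec ℕ N} {w′ : Vec ℕ M} →
  (∀ i → lookup w′ (r i) ≡ lookup w i) → (σ : Vec (Fin N) n) → look w′ (Vec.map r σ) ≡ look w σ
look-map agree [] = refl
look-map agree (i ∷ σ) = cong₂ _,_ (agree i) (look-map agree σ)

toVec : ∀ {n} → Env n → Vec ℕ n
toVec {zero} ρ = []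
toVec {suc n} (v , ρ) = v ∷ toVec ρ

look-tabulate : ∀ {N n} (w : Vec ℕ N) (ρ : Env n) (f : Fin n → Fin N) →
  (∀ i → lookup w (f i) ≡ lookup (toVec ρ) i) → look w (Vec.tabulate f) ≡ ρ
look-tabulate {n = zero} w ρ f h = refl
look-tabulate {n = suc n} w (v , ρ) f h =
  cong₂ _,_ (h fzero) (look-tabulate w ρ (λ i → f (fsuc i)) (λ i → h (fsuc i)))

look-allFin : ∀ {n} (ρ : Env n) → look (toVec ρ) (allFin n) ≡ ρ
look-allFin ρ = look-tabulate (toVec ρ) ρ (λ i → i) (λ _ → refl)

record Sys (n : ℕ) : Set where
  constructor sys
  field
    size  : ℕ
    free  : Vec (Fin size) n
    atoms : List (Atom size)

open Sys

Sat : ∀ {n} → Sys n → Env n → Set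
Sat S ρ = Σ (Vec ℕ (size S)) λ w → look w (free S) ≡ ρ × All (Holds w) (atoms S)

unify : ∀ {N n} → Vec (Fin N) n → Vec (Fin N) n → List (Atom N)
unify [] [] = []
unify (i ∷ σ) (j ∷ τ) = eq i j ∷ unify σ τ

unify⁺ : ∀ {N n} {w : Vec ℕ N} (σ τ : Vec (Fin N) n) → look w σ ≡ look w τ → All (Holds w) (unify σ τ)
unify⁺ [] [] h = []
unify⁺ (i ∷ σ) (j ∷ τ) h = cong proj₁ h ∷ unify⁺ σ τ (cong proj₂ h)

unify⁻ : ∀ {N n} {w : Vec ℕ N} (σ τ : Vec (Fin N) n) → All (Holds w) (unify σ τ) → look w σ ≡ look w τ
unify⁻ [] [] h = refl
unify⁻ (i ∷ σ) (j ∷ τ) (h ∷ hs) = cong₂ _,_ h (unify⁻ σ τ hs)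

module _ (N₁ : ℕ) {N₂ : ℕ} where
  left : Fin N₁ → Fin (N₁ + N₂)
  left i = i ↑ˡ N₂

  right : Fin N₂ → Fin (N₁ + N₂)
  right i = N₁ ↑ʳ i

  left-inj : Inj left
  left-inj = ↑ˡ-injective N₂ _ _

  right-inj : Inj right
  right-inj = ↑ʳ-injective N₁ _ _

  left≢right : ∀ i j → left i ≢ right j
  left≢right i j e with trans (sym (splitAt-↑ˡ N₁ i N₂)) (trans (cong (splitAt N₁) e) (splitAt-↑ʳ N₁ N₂ j))
  ... | ()

-- Even the common variables are duplicated and then equated by `unify`. Outputs from the two sides
-- are therefore distinct indices, as `prod` demands.
module Join {n : ℕ} (S₁ S₂ : Sys n) where
  N₁ = size S₁
  N₂ = size S₂

  σ₁ = Vec.map (left N₁ {N₂}) (free S₁)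
  σ₂ = Vec.map (right N₁ {N₂}) (free S₂)

  joined : List (Atom (N₁ + N₂))
  joined = List.map (ren (left N₁) (left-inj N₁)) (atoms S₁) List.++
           List.map (ren (right N₁) (right-inj N₁)) (atoms S₂) List.++
           unify σ₁ σ₂

  joined⁺ : ∀ w₁ w₂ → All (Holds w₁) (atoms S₁) → All (Holds w₂) (atoms S₂) →
    look (w₁ Vec.++ w₂) σ₁ ≡ look (w₁ Vec.++ w₂) σ₂ →
    All (Holds (w₁ Vec.++ w₂)) joined
  joined⁺ w₁ w₂ h₁ h₂ e =
    All.++⁺ (rens⁺ (left-inj N₁) (lookup-++ˡ w₁ w₂) _ h₁)
        (All.++⁺ (rens⁺ (right-inj N₁) (lookup-++ʳ w₁ w₂) _ h₂) (unify⁺ _ _ e))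

  joined⁻ : ∀ w₁ w₂ → All (Holds (w₁ Vec.++ w₂)) joined →
    All (Holds w₁) (atoms S₁) × All (Holds w₂) (atoms S₂) ×
    look (w₁ Vec.++ w₂) σ₁ ≡ look (w₁ Vec.++ w₂) σ₂
  joined⁻ w₁ w₂ h =
    let h′ = All.++⁻ʳ (List.map (ren (left N₁) (left-inj N₁)) (atoms S₁)) h in
    rens⁻ (left-inj N₁) (lookup-++ˡ w₁ w₂) _ (All.++⁻ˡ _ h) ,
    rens⁻ (right-inj N₁) (lookup-++ʳ w₁ w₂) _ (All.++⁻ˡ _ h′) ,
    unify⁻ _ _ (All.++⁻ʳ (List.map (ren (right N₁) (right-inj N₁)) (atoms S₂)) h′)

-- Compilation of formulas into systems.

record Compiled {n} (P : Env n → Set) : Set where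
  constructor compiled
  field
    system   : Sys n
    sound    : ∀ ρ → Sat system ρ → P ρ
    complete : ∀ ρ → P ρ → Sat system ρ

open Compiled

-- The atoms define the graph of a total function: `value` forces the output, `solution` extends
-- every environment.
record Evaluated {n} (f : Env n → ℕ) : Set where
  field
    {N}      : ℕ
    out      : Fin N
    σ        : Vec (Fin N) n
    as       : List (Atom N)
    value    : ∀ w → All (Holds w) as → lookup w out ≡ f (look w σ)
    solution : ∀ ρ → Σ (Vec ℕ N) λ w → look w σ ≡ ρ × All (Holds w) as

record EvaluatedTwo {n} (f g : Env n → ℕ) : Set where
  field
    {N}      : ℕ
    i j      : Fin N
    i≢j      : i ≢ j
    σ        : Vec (Fin N) n
    as       : List (Atom N)
    value₁   : ∀ w → All (Holds w) as → lookup w i ≡ f (look w σ)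
    value₂   : ∀ w → All (Holds w) as → lookup w j ≡ g (look w σ)
    solution : ∀ ρ → Σ (Vec ℕ N) λ w → look w σ ≡ ρ × All (Holds w) as

evaluateTwo : ∀ {n} {f g : Env n → ℕ} → Evaluated f → Evaluated g → EvaluatedTwo f g
evaluateTwo {n} {f} {g} F G = record
  { N = J.N₁ + J.N₂ ; i = left J.N₁ F.out ; j = right J.N₁ G.out ; i≢j = left≢right J.N₁ _ _
  ; σ = J.σ₁ ; as = J.joined ; value₁ = val₁ ; value₂ = val₂ ; solution = sol }
  where
  module F = Evaluated F
  module G = Evaluated G
  module J = Join {n} (sys F.N F.σ F.as) (sys G.N G.σ G.as)
  val₁ : ∀ w → All (Holds w) J.joined → lookup w (left J.N₁ F.out) ≡ f (look w J.σ₁)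
  val₁ w hs with Vec.splitAt J.N₁ w
  ... | w₁ , w₂ , refl =
    trans (lookup-++ˡ w₁ w₂ F.out)
      (trans (F.value w₁ (proj₁ (J.joined⁻ w₁ w₂ hs))) (cong f (sym (look-map (lookup-++ˡ w₁ w₂) F.σ))))
  val₂ : ∀ w → All (Holds w) J.joined → lookup w (right J.N₁ G.out) ≡ g (look w J.σ₁)
  val₂ w hs with Vec.splitAt J.N₁ w
  ... | w₁ , w₂ , refl with J.joined⁻ w₁ w₂ hs
  ... | _ , h₂ , e =
    trans (lookup-++ʳ w₁ w₂ G.out)
      (trans (G.value w₂ h₂) (cong g (trans (sym (look-map (lookup-++ʳ w₁ w₂) G.σ)) (sym e))))
  sol : ∀ ρ → Σ (Vec ℕ (J.N₁ + J.N₂)) λ w → look w J.σ₁ ≡ ρ × All (Holds w) J.joined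
  sol ρ with F.solution ρ | G.solution ρ
  ... | w₁ , e₁ , h₁ | w₂ , e₂ , h₂ =
    let l = trans (look-map (lookup-++ˡ w₁ w₂) F.σ) e₁
        r = trans (look-map (lookup-++ʳ w₁ w₂) G.σ) e₂
    in w₁ Vec.++ w₂ , l , J.joined⁺ w₁ w₂ h₁ h₂ (trans l (sym r))

-- A fresh variable with index 0 receives the result of an operation.
module Fresh {N n : ℕ} (σ : Vec (Fin N) n) (as : List (Atom N)) where
  σ′ : Vec (Fin (suc N)) n
  σ′ = Vec.map fsuc σ

  as′ : List (Atom (suc N))
  as′ = List.map (ren fsuc fsuc-injective) as

  fresh⁺ : ∀ v w → All (Holds w) as → All (Holds (v ∷ w)) as′
  fresh⁺ v w = rens⁺ fsuc-injective (λ _ → refl) as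

  fresh⁻ : ∀ v w → All (Holds (v ∷ w)) as′ → All (Holds w) as
  fresh⁻ v w = rens⁻ fsuc-injective (λ _ → refl) as

  look-fresh : ∀ v w → look (v ∷ w) σ′ ≡ look w σ
  look-fresh v w = look-map (λ _ → refl) σ

module _ {n : ℕ} {f g : Env n → ℕ} (E : EvaluatedTwo f g) where
  private
    module E = EvaluatedTwo E
  open Fresh E.σ E.as

  evaluateOp : (op : ℕ → ℕ → ℕ)
    (atom : ∀ {N} (i j k : Fin N) → i ≢ j → Atom N)
    (atom⁺ : ∀ {N} (w : Vec ℕ N) i j k ne → op (lookup w i) (lookup w j) ≡ lookup w k → Holds w (atom i j k ne))
    (atom⁻ : ∀ {N} (w : Vec ℕ N) i j k ne → Holds w (atom i j k ne) → op (lookup w i) (lookup w j) ≡ lookup w k) →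
    Evaluated (λ ρ → op (f ρ) (g ρ))
  evaluateOp op atom atom⁺ atom⁻ = record
    { out = fzero ; σ = σ′
    ; as = atom (fsuc E.i) (fsuc E.j) fzero (λ e → E.i≢j (fsuc-injective e)) ∷ as′
    ; value = λ { (v ∷ w) (h ∷ hs) →
        trans (sym (atom⁻ (v ∷ w) _ _ _ _ h))
          (trans (cong₂ op (E.value₁ w (fresh⁻ v w hs)) (E.value₂ w (fresh⁻ v w hs)))
                 (cong (λ ρ → op (f ρ) (g ρ)) (sym (look-fresh v w)))) }
    ; solution = λ ρ → let w , e , hs = E.solution ρ
                           v = op (lookup w E.i) (lookup w E.j) in
        v ∷ w , trans (look-fresh v w) e , atom⁺ (v ∷ w) _ _ _ _ refl ∷ fresh⁺ v w hs }

evaluate : ∀ {k n} {f : Env n → ℕ} → Tm k f → Evaluated f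
evaluate top = record
  { out = fzero ; σ = allFin _ ; as = []
  ; value = λ { (v ∷ w) _ → refl } ; solution = λ ρ → toVec ρ , look-allFin ρ , [] }
evaluate (pop {f = f} t) = record
  { out = fsuc E.out ; σ = fzero ∷ σ′ ; as = as′
  ; value = λ { (v ∷ w) hs → trans (E.value w (fresh⁻ v w hs)) (cong f (sym (look-fresh v w))) }
  ; solution = λ { (v , ρ) → let w , e , hs = E.solution ρ in
      v ∷ w , cong (v ,_) (trans (look-fresh v w) e) , fresh⁺ v w hs } }
  where
  module E = Evaluated (evaluate t)
  open Fresh E.σ E.as
evaluate (con {n = n} c) = record
  { out = fzero ; σ = Vec.map fsuc (allFin n) ; as = is fzero c ∷ []
  ; value = λ { (v ∷ w) (h ∷ []) → h }
  ; solution = λ ρ → c ∷ toVec ρ , trans (look-map (λ _ → refl) (allFin n)) (look-allFin ρ) , refl ∷ [] }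
evaluate (t ⊕ u) = evaluateOp (evaluateTwo (evaluate t) (evaluate u)) _+_ sum (λ _ _ _ _ _ h → h) (λ _ _ _ _ _ h → h)
evaluate (t ⊛ u) = evaluateOp (evaluateTwo (evaluate t) (evaluate u)) _*_ prod (λ _ _ _ _ _ h → h) (λ _ _ _ _ _ h → h)
evaluate (two^ {f = f} t) = record
  { out = fzero ; σ = σ′ ; as = pow (fsuc E.out) fzero ∷ as′
  ; value = λ { (v ∷ w) (h ∷ hs) → trans (sym h)
      (trans (cong (2 ^_) (E.value w (fresh⁻ v w hs))) (cong (λ ρ → 2 ^ f ρ) (sym (look-fresh v w)))) }
  ; solution = λ ρ → let w , e , hs = E.solution ρ
                         v = 2 ^ lookup w E.out in
      v ∷ w , trans (look-fresh v w) e , refl ∷ fresh⁺ v w hs }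
  where
  module E = Evaluated (evaluate t)
  open Fresh E.σ E.as

compile : ∀ {k n} {P : Env n → Set} → Dio k P → Compiled P
compile {n = n} (_≐_ {f = f} {g} t u) = record
  { system = sys E.N E.σ (eq E.i E.j ∷ E.as)
  ; sound = λ { _ (w , refl , h ∷ hs) → trans (sym (E.value₁ w hs)) (trans h (E.value₂ w hs)) }
  ; complete = λ ρ h → let w , e , hs = E.solution ρ in
      w , e , trans (E.value₁ w hs) (trans (subst (λ ρ → f ρ ≡ g ρ) (sym e) h) (sym (E.value₂ w hs))) ∷ hs }
  where module E = EvaluatedTwo (evaluateTwo (evaluate t) (evaluate u))
compile {n = n} (_∧_ {P = P} {Q} p q) = record
  { system = sys (J.N₁ + J.N₂) J.σ₁ J.joined ; sound = snd ; complete = cmp }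
  where
  module A = Compiled (compile p)
  module B = Compiled (compile q)
  module J = Join {n} A.system B.system
  snd : ∀ ρ → Sat (sys (J.N₁ + J.N₂) J.σ₁ J.joined) ρ → P ρ × Q ρ
  snd ρ (w , e , hs) with Vec.splitAt J.N₁ w
  ... | w₁ , w₂ , refl with J.joined⁻ w₁ w₂ hs
  ... | h₁ , h₂ , e′ =
    A.sound ρ (w₁ , trans (sym (look-map (lookup-++ˡ w₁ w₂) (free A.system))) e , h₁) ,
    B.sound ρ (w₂ , trans (sym (look-map (lookup-++ʳ w₁ w₂) (free B.system))) (trans (sym e′) e) , h₂)
  cmp : ∀ ρ → P ρ × Q ρ → Sat (sys (J.N₁ + J.N₂) J.σ₁ J.joined) ρ
  cmp ρ (a , b) with A.complete ρ a | B.complete ρ b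
  ... | w₁ , e₁ , h₁ | w₂ , e₂ , h₂ =
    let l = trans (look-map (lookup-++ˡ w₁ w₂) (free A.system)) e₁
        r = trans (look-map (lookup-++ʳ w₁ w₂) (free B.system)) e₂
    in w₁ Vec.++ w₂ , l , J.joined⁺ w₁ w₂ h₁ h₂ (trans l (sym r))
compile (ex {P = P} p) = record
  -- The bound variable stays an unknown and merely leaves the free list, because solvability
  -- already quantifies existentially.
  { system = sys (size S) (Vec.tail (free S)) (atoms S) ; sound = snd ; complete = cmp }
  where
  S = system (compile p)
  snd : ∀ ρ → Sat (sys (size S) (Vec.tail (free S)) (atoms S)) ρ → Σ ℕ λ v → P (v , ρ)
  snd ρ (w , e , hs) with free S | sound (compile p)
  ... | i ∷ σ | snd′ = lookup w i , snd′ _ (w , cong (lookup w i ,_) e , hs)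
  cmp : ∀ ρ → (Σ ℕ λ v → P (v , ρ)) → Sat (sys (size S) (Vec.tail (free S)) (atoms S)) ρ
  cmp ρ (v , h) with free S | complete (compile p) (v , ρ) h
  ... | i ∷ σ | w , e , hs = w , cong proj₂ e , hs
compile (iff to from p) = record
  { system = system (compile p)
  ; sound = λ ρ h → to ρ (sound (compile p) ρ h)
  ; complete = λ ρ h → complete (compile p) ρ (from ρ h) }

-- Division with remainder and numerals in a given base.

quotient-unique : ∀ n {a a′} q q′ → a < n → a′ < n → a + n * q ≡ a′ + n * q′ → a ≡ a′ × q ≡ q′
quotient-unique n {a} {a′} zero zero _ _ e =
  trans (sym (trans (cong (a +_) (*-zeroʳ n)) (+-identityʳ a)))
    (trans e (trans (cong (a′ +_) (*-zeroʳ n)) (+-identityʳ a′))) , refl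
quotient-unique n {a} {a′} zero (suc q′) a<n _ e =
  ⊥-elim (<⇒≱ a<n (subst (n ≤_) (sym (trans (sym (trans (cong (a +_) (*-zeroʳ n)) (+-identityʳ a))) e))
    (≤-trans (m≤m*n n (suc q′)) (m≤n+m _ a′))))
quotient-unique n {a} {a′} (suc q) zero _ a′<n e =
  ⊥-elim (<⇒≱ a′<n (subst (n ≤_) (trans e (trans (cong (a′ +_) (*-zeroʳ n)) (+-identityʳ a′)))
    (≤-trans (m≤m*n n (suc q)) (m≤n+m _ a))))
quotient-unique n {a} {a′} (suc q) (suc q′) a<n a′<n e
  with quotient-unique n q q′ a<n a′<n
         (+-cancelˡ-≡ n _ _ (trans (lem n a q) (trans e (sym (lem n a′ q′)))))
  where lem : ∀ n a q → n + (a + n * q) ≡ a + n * suc q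
        lem = solve-∀
... | a≡ , q≡ = a≡ , cong suc q≡

divide : ∀ n m → 0 < n → Σ ℕ λ r → Σ ℕ λ q → r < n × m ≡ r + n * q
divide n zero 0<n = 0 , 0 , 0<n , sym (*-zeroʳ n)
divide n (suc m) 0<n with divide n m 0<n
... | r , q , r<n , e with suc r ≟ n
... | yes refl = 0 , suc q , 0<n , trans (cong suc e) (sym (*-suc (suc r) q))
... | no  r≢ = suc r , q , ≤∧≢⇒< r<n r≢ , cong suc e

-- Least significant digit first. Digits may exceed `B`, since one list is read in several bases;
-- the uniqueness lemmas ask for the bounds.
rep : ℕ → (ℕ → ℕ) → ℕ → ℕ
rep B f zero = 0
rep B f (suc T) = f 0 + B * rep B (f ∘ suc) T

rep-cong : ∀ B {f g} T → (∀ t → t < T → f t ≡ g t) → rep B f T ≡ rep B g T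
rep-cong B zero h = refl
rep-cong B (suc T) h = cong₂ (λ a b → a + B * b) (h 0 (s≤s z≤n)) (rep-cong B T (λ t lt → h (suc t) (s≤s lt)))

rep-unique : ∀ B {f g} T → (∀ t → t < T → f t < B) → (∀ t → t < T → g t < B) →
  rep B f T ≡ rep B g T → ∀ t → t < T → f t ≡ g t
rep-unique B (suc T) hf hg e t lt with quotient-unique B _ _ (hf 0 (s≤s z≤n)) (hg 0 (s≤s z≤n)) e
rep-unique B (suc T) hf hg e zero lt | e₀ , e₁ = e₀
rep-unique B (suc T) hf hg e (suc t) (s≤s lt) | e₀ , e₁ =
  rep-unique B T (λ t lt → hf (suc t) (s≤s lt)) (λ t lt → hg (suc t) (s≤s lt)) e₁ t lt

rep-< : ∀ B {f} T → (∀ t → t < T → f t < B) → rep B f T < B ^ T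
rep-< B zero h = s≤s z≤n
rep-< B {f} (suc T) h = begin-strict
  f 0 + B * rep B (f ∘ suc) T   <⟨ +-monoˡ-< _ (h 0 (s≤s z≤n)) ⟩
  B + B * rep B (f ∘ suc) T     ≡⟨ *-suc B _ ⟨
  B * suc (rep B (f ∘ suc) T)   ≤⟨ *-monoʳ-≤ B (rep-< B T (λ t lt → h (suc t) (s≤s lt))) ⟩
  B * B ^ T ∎
  where open ≤-Reasoning

rep-+ : ∀ B f g T → rep B (λ t → f t + g t) T ≡ rep B f T + rep B g T
rep-+ B f g zero = refl
rep-+ B f g (suc T) = trans (cong (λ r → f 0 + g 0 + B * r) (rep-+ B (f ∘ suc) (g ∘ suc) T)) (lem (f 0) (g 0) B _ _)
  where lem : ∀ a b B r s → a + b + B * (r + s) ≡ a + B * r + (b + B * s)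
        lem = solve-∀

rep-snoc : ∀ B f T → rep B f (suc T) ≡ rep B f T + B ^ T * f T
rep-snoc B f zero = lem (f 0) B
  where lem : ∀ a B → a + B * 0 ≡ 1 * a
        lem = solve-∀
rep-snoc B f (suc T) = trans (cong (λ r → f 0 + B * r) (rep-snoc B (f ∘ suc) T)) (lem (f 0) B _ (B ^ T) _)
  where lem : ∀ a B r p z → a + B * (r + p * z) ≡ a + B * r + B * p * z
        lem = solve-∀

-- Lucas' theorem modulo 2

bin : ℕ → ℕ → ℕ
bin n zero = 1
bin zero (suc k) = 0
bin (suc n) (suc k) = bin n k + bin n (suc k)

odd : ℕ → Bool
odd zero = false
odd (suc n) = not (odd n)

odd-+ : ∀ a b → odd (a + b) ≡ odd a xor odd b
odd-+ zero b = refl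
odd-+ (suc a) b rewrite odd-+ a b with odd a | odd b
... | true | true = refl
... | true | false = refl
... | false | true = refl
... | false | false = refl

odd-witness : ∀ n → odd n ≡ true → Σ ℕ λ h → n ≡ 1 + 2 * h
odd-witness (suc zero) e = 0 , refl
odd-witness (suc (suc n)) e with odd n in h
... | true with odd-witness n h
...   | h , refl = suc h , lem h
  where lem : ∀ h → suc (suc (1 + 2 * h)) ≡ 1 + 2 * suc h
        lem = solve-∀

odd-1+2* : ∀ h → odd (1 + 2 * h) ≡ true
odd-1+2* zero = refl
odd-1+2* (suc h) = trans (cong odd (lem h)) (cong (not ∘ not) (odd-1+2* h))
  where lem : ∀ h → 1 + 2 * suc h ≡ suc (suc (1 + 2 * h))
        lem = solve-∀

-- Pascal's rule over the field with two elements, so that parities are computed without the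
-- coefficients.
bin₂ : ℕ → ℕ → Bool
bin₂ n zero = true
bin₂ zero (suc k) = false
bin₂ (suc n) (suc k) = bin₂ n k xor bin₂ n (suc k)

odd-bin : ∀ n k → odd (bin n k) ≡ bin₂ n k
odd-bin n zero = refl
odd-bin zero (suc k) = refl
odd-bin (suc n) (suc k) = trans (odd-+ (bin n k) _) (cong₂ _xor_ (odd-bin n k) (odd-bin n (suc k)))

double : ℕ → ℕ
double zero = zero
double (suc n) = suc (suc (double n))

bit : Bool → ℕ → ℕ
bit false n = double n
bit true n = suc (double n)

bit# : Bool → ℕ
bit# false = 0
bit# true = 1

double-* : ∀ n → double n ≡ 2 * n
double-* zero = refl
double-* (suc n) = trans (cong (suc ∘ suc) (double-* n)) (lem n)
  where lem : ∀ n → suc (suc (2 * n)) ≡ 2 * suc n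
        lem = solve-∀

bit-* : ∀ α n → bit α n ≡ bit# α + 2 * n
bit-* false n = double-* n
bit-* true n = cong suc (double-* n)

unbit : ∀ n → Σ Bool λ α → Σ ℕ λ m → n ≡ bit α m
unbit zero = false , 0 , refl
unbit (suc n) with unbit n
... | false , m , e = true , m , cong suc e
... | true , m , e = false , suc m , cong suc e

xor-self : ∀ a → a xor a ≡ false
xor-self true = refl
xor-self false = refl

-- Pascal's rule leads from each combination of parities to the others. In `lucas-01` its two
-- summands are equal and cancel.
lucas-00 : ∀ n k → bin₂ (double n) (double k) ≡ bin₂ n k
lucas-01 : ∀ n k → bin₂ (double n) (suc (double k)) ≡ false
lucas-10 : ∀ n k → bin₂ (suc (double n)) (double k) ≡ bin₂ n k
lucas-11 : ∀ n k → bin₂ (suc (double n)) (suc (double k)) ≡ bin₂ n k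
lucas-00 n zero = refl
lucas-00 zero (suc k) = refl
lucas-00 (suc n) (suc k) = cong₂ _xor_ (lucas-11 n k) (lucas-10 n (suc k))
lucas-01 zero k = refl
lucas-01 (suc n) k = trans (cong₂ _xor_ (lucas-10 n k) (lucas-11 n k)) (xor-self (bin₂ n k))
lucas-10 n zero = refl
lucas-10 n (suc k) = cong₂ _xor_ (lucas-01 n k) (lucas-00 n (suc k))
lucas-11 n k rewrite lucas-00 n k | lucas-01 n k with bin₂ n k
... | true = refl
... | false = refl

_below_ : Bool → Bool → Bool
true below α = α
false below α = true

lucas : ∀ α β n k → bin₂ (bit α n) (bit β k) ≡ (β below α) & bin₂ n k
lucas false false n k = lucas-00 n k
lucas false true n k = lucas-01 n k
lucas true false n k = lucas-10 n k
lucas true true n k = lucas-11 n k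

bit-half : ∀ α n b → bit α n < 2 ^ suc b → n < 2 ^ b
bit-half α n b h = *-cancelˡ-< 2 n (2 ^ b) (≤-<-trans (≤-trans (m≤n+m _ (bit# α)) (≤-reflexive (sym (bit-* α n)))) h)

&-assoc : ∀ a b c → a & (b & c) ≡ (a & b) & c
&-assoc true b c = refl
&-assoc false b c = refl

-- Applying `lucas` to the `b` low bits one at a time splits off a whole digit in base `2 ^ b`.
lucas-block : ∀ b m v M V → m < 2 ^ b → v < 2 ^ b →
  bin₂ (m + 2 ^ b * M) (v + 2 ^ b * V) ≡ bin₂ m v & bin₂ M V
lucas-block zero zero zero M V _ _ = cong₂ bin₂ (+-identityʳ M) (+-identityʳ V)
lucas-block zero zero (suc v) M V _ (s≤s ())
lucas-block zero (suc m) v M V (s≤s ()) _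
lucas-block (suc b) m v M V hm hv with unbit m | unbit v
... | α , m , refl | β , v , refl = begin
  bin₂ (bit α m + 2 ^ suc b * M) (bit β v + 2 ^ suc b * V)  ≡⟨ cong₂ bin₂ (shift α m M) (shift β v V) ⟩
  bin₂ (bit α (m + 2 ^ b * M)) (bit β (v + 2 ^ b * V))      ≡⟨ lucas α β (m + 2 ^ b * M) (v + 2 ^ b * V) ⟩
  (β below α) & bin₂ (m + 2 ^ b * M) (v + 2 ^ b * V)
    ≡⟨ cong ((β below α) &_) (lucas-block b m v M V (bit-half α m b hm) (bit-half β v b hv)) ⟩
  (β below α) & (bin₂ m v & bin₂ M V)                       ≡⟨ &-assoc (β below α) _ _ ⟩
  ((β below α) & bin₂ m v) & bin₂ M V                       ≡⟨ cong (_& bin₂ M V) (lucas α β m v) ⟨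
  bin₂ (bit α m) (bit β v) & bin₂ M V ∎
  where
  open ≡-Reasoning
  lem : ∀ a m p M → a + 2 * m + 2 * p * M ≡ a + 2 * (m + p * M)
  lem = solve-∀
  shift : ∀ α m M → bit α m + 2 ^ suc b * M ≡ bit α (m + 2 ^ b * M)
  shift α m M = trans (cong (_+ 2 ^ suc b * M) (bit-* α m))
    (trans (lem (bit# α) m (2 ^ b) M) (sym (bit-* α (m + 2 ^ b * M))))

mask : ℕ → ℕ
mask zero = 0
mask (suc c) = bit true (mask c)

suc-mask : ∀ c → suc (mask c) ≡ 2 ^ c
suc-mask zero = refl
suc-mask (suc c) = trans (cong suc (bit-* true (mask c))) (trans (lem (mask c)) (cong (2 *_) (suc-mask c)))
  where lem : ∀ m → suc (1 + 2 * m) ≡ 2 * suc m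
        lem = solve-∀

-- All `c` low bits of the mask are set, so every number of at most `c` bits is bitwise below it.
bin₂-mask : ∀ c v → v < 2 ^ c → bin₂ (mask c) v ≡ true
bin₂-mask zero zero h = refl
bin₂-mask zero (suc v) (s≤s ())
bin₂-mask (suc c) v h with unbit v
... | β , v , refl rewrite lucas true β (mask c) v | bin₂-mask c v (bit-half β v c h) with β
... | true = refl
... | false = refl

bin₂-above : ∀ n k → n < k → bin₂ n k ≡ false
bin₂-above zero (suc k) h = refl
bin₂-above (suc n) (suc k) (s≤s h)
  rewrite bin₂-above n k h | bin₂-above n (suc k) (m<n⇒m<1+n h) = refl

-- By Lucas, the numbers V with bin M V odd, M having the digit mask c in every
-- place, are those whose digits in base 2 ^ b are all below 2 ^ c.
bin₂-rep⁺ : ∀ b c T v → c ≤ b → (∀ t → t < T → v t < 2 ^ c) →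
  bin₂ (rep (2 ^ b) (λ _ → mask c) T) (rep (2 ^ b) v T) ≡ true
bin₂-rep⁺ b c zero v c≤b h = refl
bin₂-rep⁺ b c (suc T) v c≤b h
  rewrite lucas-block b (mask c) (v 0) (rep (2 ^ b) (λ _ → mask c) T) (rep (2 ^ b) (v ∘ suc) T)
            (≤-trans (≤-reflexive (suc-mask c)) (^-monoʳ-≤ 2 c≤b))
            (<-≤-trans (h 0 (s≤s z≤n)) (^-monoʳ-≤ 2 c≤b))
        | bin₂-mask c (v 0) (h 0 (s≤s z≤n)) =
  bin₂-rep⁺ b c T (v ∘ suc) c≤b (λ t lt → h (suc t) (s≤s lt))

0<2^ : ∀ n → 0 < 2 ^ n
0<2^ n = m^n>0 2 n

n<2^n : ∀ n → n < 2 ^ n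
n<2^n zero = s≤s z≤n
n<2^n (suc n) = subst₂ _<_ (+-identityʳ (suc n)) (cong (2 ^ n +_) (sym (+-identityʳ (2 ^ n)))) (+-mono-≤-< (n<2^n n) (0<2^ n))

infixr 5 _◂_
_◂_ : ∀ {A : Set} → A → (ℕ → A) → ℕ → A
(a ◂ f) zero = a
(a ◂ f) (suc t) = f t

bin₂-rep⁻ : ∀ b c T V → c ≤ b → bin₂ (rep (2 ^ b) (λ _ → mask c) T) V ≡ true →
  Σ (ℕ → ℕ) λ v → (∀ t → t < T → v t < 2 ^ c) × V ≡ rep (2 ^ b) v T
bin₂-rep⁻ b c zero zero c≤b h = (λ _ → 0) , (λ _ ()) , refl
bin₂-rep⁻ b c (suc T) V c≤b h with divide (2 ^ b) V (0<2^ b)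
... | r , q , r<B , refl
  rewrite lucas-block b (mask c) r (rep (2 ^ b) (λ _ → mask c) T) q
            (≤-trans (≤-reflexive (suc-mask c)) (^-monoʳ-≤ 2 c≤b)) r<B
  with r <? 2 ^ c
-- Such a digit exceeds the mask, so its coefficient vanishes, against oddness.
... | no r≮ rewrite bin₂-above (mask c) r (≤-trans (≤-reflexive (suc-mask c)) (≮⇒≥ r≮)) with () ← h
... | yes r< rewrite bin₂-mask c r r< with bin₂-rep⁻ b c T q c≤b h
... | v , hv , refl = (r ◂ v) , (λ { zero _ → r< ; (suc t) (s≤s lt) → hv t lt }) , refl

-- Binomial coefficients as digits of a power.

bin-≤ : ∀ n k → bin n k ≤ 2 ^ n
bin-≤ n zero = 0<2^ n
bin-≤ zero (suc k) = z≤n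
bin-≤ (suc n) (suc k) = ≤-trans (+-mono-≤ (bin-≤ n k) (bin-≤ n (suc k))) (≤-reflexive (lem (2 ^ n)))
  where lem : ∀ p → p + p ≡ 2 * p
        lem = solve-∀

-- A congruence modulo `m`, with the quotient exhibited because formulas can assert it only through
-- a witness.
power-mod : ∀ m b n → Σ ℕ λ q → (m + b) ^ n ≡ b ^ n + m * q
power-mod m b zero = 0 , cong (1 +_) (sym (*-zeroʳ m))
power-mod m b (suc n) with power-mod m b n
... | q , e = b ^ n + (m + b) * q , trans (cong ((m + b) *_) e) (lem m b (b ^ n) q)
  where lem : ∀ m b p q → (m + b) * (p + m * q) ≡ b * p + m * (p + (m + b) * q)
        lem = solve-∀

-- bin n k is the k-th digit of (1 + u) ^ n in base u; the stated bound on the lower part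
-- survives the induction and gives lo < u ^ k once 2 ^ n < u.
binomial-digit : ∀ u → 0 < u → ∀ n k → Σ ℕ λ lo → Σ ℕ λ hi →
  (1 + u) ^ n ≡ lo + u ^ k * (bin n k + u * hi) × u * lo ≤ 2 ^ n * u ^ k
binomial-digit u 0<u zero zero = 0 , 0 , lem u , ≤-trans (≤-reflexive (*-zeroʳ u)) z≤n
  where lem : ∀ u → 1 ≡ 0 + 1 * (1 + u * 0)
        lem = solve-∀
binomial-digit u 0<u (suc n) zero with power-mod u 1 (suc n)
... | q , e = 0 , q , trans (cong (_^ suc n) (+-comm 1 u)) (trans e (trans (cong (_+ u * q) (^-zeroˡ (suc n))) (sym (*-identityˡ _)))) ,
  ≤-trans (≤-reflexive (*-zeroʳ u)) z≤n
binomial-digit u 0<u zero (suc k) = 1 , 0 , lem u (u ^ k) , ≤-trans (*-monoʳ-≤ u (m^n>0 u {{>-nonZero 0<u}} k)) (≤-reflexive (sym (+-identityʳ _)))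
  where
  lem : ∀ u p → 1 ≡ 1 + u * p * (0 + u * 0)
  lem = solve-∀
binomial-digit u 0<u (suc n) (suc k) with binomial-digit u 0<u n k | binomial-digit u 0<u n (suc k)
... | lo₀ , hi₀ , e₀ , b₀ | lo₁ , hi₁ , e₁ , b₁ =
  lo₁ + u * lo₀ , hi₁ + hi₀ ,
  trans (cong₂ (λ p q → p + u * q) e₁ e₀) (lem u (u ^ k) lo₀ lo₁ hi₀ hi₁ (bin n k) (bin n (suc k))) ,
  (begin
    u * (lo₁ + u * lo₀)                      ≡⟨ *-distribˡ-+ u lo₁ _ ⟩
    u * lo₁ + u * (u * lo₀)                  ≤⟨ +-mono-≤ b₁ (*-monoʳ-≤ u b₀) ⟩
    2 ^ n * (u * u ^ k) + u * (2 ^ n * u ^ k) ≡⟨ lem′ u (2 ^ n) (u ^ k) ⟩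
    2 * 2 ^ n * (u * u ^ k) ∎)
  where
  open ≤-Reasoning
  lem : ∀ u p lo₀ lo₁ hi₀ hi₁ b c →
    lo₁ + u * p * (c + u * hi₁) + u * (lo₀ + p * (b + u * hi₀)) ≡
    lo₁ + u * lo₀ + u * p * (b + c + u * (hi₁ + hi₀))
  lem = solve-∀
  lem′ : ∀ u t p → t * (u * p) + u * (t * p) ≡ 2 * t * (u * p)
  lem′ = solve-∀

binomial-digit-< : ∀ u n k → 2 ^ n < u → Σ ℕ λ lo → Σ ℕ λ hi →
  (1 + u) ^ n ≡ lo + u ^ k * (bin n k + u * hi) × lo < u ^ k
binomial-digit-< u n k h with binomial-digit u (≤-<-trans z≤n h) n k
... | lo , hi , e , b = lo , hi , e , *-cancelˡ-< u lo (u ^ k) (≤-<-trans b (*-monoˡ-< (u ^ k) {{>-nonZero (m^n>0 u {{>-nonZero (≤-<-trans z≤n h)}} k)}} h))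

-- Exponential definitions of powers, odd binomial coefficients and digit bounds.

infix 4 _≺_
_≺_ : ∀ {k n} {f g : Env n → ℕ} → Tm k f → Tm k g → Dio k (λ ρ → f ρ < g ρ)
_≺_ {f = f} {g} t u = iff
  (λ ρ (d , e) → subst (f ρ <_) e (s≤s (m≤m+n (f ρ) d)))
  (λ ρ h → let d , e = m≤n⇒∃[o]m+o≡n h in d , e)
  (ex (con 1 ⊕ pop t ⊕ top ≐ pop u))

-- With a ≡ 1 + 2 ^ (1 + M), the power a ^ M is the residue of 2 ^ (z * M) modulo 2 ^ z ∸ a.
big : ℕ → ℕ
big M = (M + 2) * (M + 1) + 1

base : ℕ → ℕ
base M = 2 ^ suc M

-- The exponent makes the modulus exceed the power of `a`, which stands for `1 + base M`: as `a` is
-- below `2 ^ (M + 2)`, its power is at most `2 ^ ((M + 2) * M)`. The factor `M + 1` in place of `M`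
-- makes room for the summand `a`, and the final 1 doubles the bound.
big-enough : ∀ M → (1 + base M) ^ M + (1 + base M) < 2 ^ big M
big-enough M = begin-strict
  (1 + base M) ^ M + (1 + base M)     ≤⟨ +-monoˡ-≤ _ (^-monoˡ-≤ M (<⇒≤ small)) ⟩
  (2 ^ (M + 2)) ^ M + (1 + base M)    <⟨ +-monoʳ-< _ small ⟩
  (2 ^ (M + 2)) ^ M + 2 ^ (M + 2)     ≡⟨ cong (_+ 2 ^ (M + 2)) (^-*-assoc 2 (M + 2) M) ⟩
  2 ^ ((M + 2) * M) + 2 ^ (M + 2)
    ≤⟨ +-mono-≤ (^-monoʳ-≤ 2 (*-monoʳ-≤ (M + 2) (m≤m+n M 1))) (^-monoʳ-≤ 2 (m≤m*n (M + 2) (M + 1) {{>-nonZero (m≤n+m 1 M)}})) ⟩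
  2 ^ ((M + 2) * (M + 1)) + 2 ^ ((M + 2) * (M + 1)) ≡⟨ lem (2 ^ ((M + 2) * (M + 1))) ⟩
  2 ^ ((M + 2) * (M + 1)) * 2 ^ 1     ≡⟨ ^-distribˡ-+-* 2 ((M + 2) * (M + 1)) 1 ⟨
  2 ^ big M ∎
  where
  open ≤-Reasoning
  lem : ∀ p → p + p ≡ p * 2
  lem = solve-∀
  lem′ : ∀ p → 2 * p + 2 * p ≡ p * 4
  lem′ = solve-∀
  small : 1 + base M < 2 ^ (M + 2)
  small = begin-strict
    1 + base M                ≤⟨ +-monoˡ-≤ _ (0<2^ M) ⟩
    2 ^ M + base M            <⟨ +-monoˡ-< (base M) (m<m*n (2 ^ M) 2 {{>-nonZero (0<2^ M)}} (s≤s (s≤s z≤n))) ⟩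
    2 ^ M * 2 + 2 * 2 ^ M     ≡⟨ cong (_+ 2 * 2 ^ M) (*-comm (2 ^ M) 2) ⟩
    2 * 2 ^ M + 2 * 2 ^ M     ≡⟨ lem′ (2 ^ M) ⟩
    2 ^ M * 2 ^ 2             ≡⟨ ^-distribˡ-+-* 2 M 2 ⟨
    2 ^ (M + 2) ∎

-- Terms have powers of 2 only, whereas the digits of a binomial expansion call for a power with a
-- variable base. Here `m` is the modulus `2 ^ big M ∸ (1 + base M)`, so that `2 ^ big M` is
-- congruent to that base.
Residue : ℕ → ℕ → Set
Residue M W = Σ ℕ λ m → Σ ℕ λ k →
  2 ^ big M ≡ m + (1 + base M) × 2 ^ (big M * M) ≡ W + m * k × W < m

residue⁻ : ∀ M W → Residue M W → W ≡ (1 + base M) ^ M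
residue⁻ M W (m , k , e , e′ , W<m) with power-mod m (1 + base M) M
... | q , e″ = proj₁ (quotient-unique m k q W<m
  (+-cancelʳ-< (1 + base M) _ _ (<-≤-trans (big-enough M) (≤-reflexive e)))
  (trans (sym e′) (trans (sym (^-*-assoc 2 (big M) M)) (trans (cong (_^ M) e) e″))))

residue⁺ : ∀ M → Residue M ((1 + base M) ^ M)
residue⁺ M with m≤n⇒∃[o]m+o≡n (big-enough M)
... | d , e with power-mod (suc ((1 + base M) ^ M) + d) (1 + base M) M
... | q , e″ =
  suc ((1 + base M) ^ M) + d , q , e‴ ,
  trans (sym (^-*-assoc 2 (big M) M)) (trans (cong (_^ M) e‴) e″) , s≤s (m≤m+n _ d)
  where
  lem : ∀ a b d → suc (a + b) + d ≡ suc a + d + b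
  lem = solve-∀
  e‴ : 2 ^ big M ≡ suc ((1 + base M) ^ M) + d + (1 + base M)
  e‴ = trans (sym e) (lem ((1 + base M) ^ M) (1 + base M) d)

residue : ∀ {n} {M W : Env n → ℕ} → Tm exp M → Tm exp W → Dio exp (λ ρ → Residue (M ρ) (W ρ))
residue M W = ex (ex (two^ z ≐ pop top ⊕ (con 1 ⊕ two^ (con 1 ⊕ M′)) ∧
  two^ (z ⊛ M′) ≐ pop (pop W) ⊕ pop top ⊛ top ∧ pop (pop W) ≺ pop top))
  where
  M′ = pop (pop M)
  z = (M′ ⊕ con 2) ⊛ (M′ ⊕ con 1) ⊕ con 1

-- With `u` for `base M`, the number `W` is `(1 + u) ^ M`, and its digit at `u ^ V` is `bin M V`,
-- which is below `u` because `u` is twice `2 ^ M`. Writing this digit as `1 + 2 * h` states its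
-- oddness.
OddBin : ℕ → ℕ → Set
OddBin M V = Σ ℕ λ W → Σ ℕ λ lo → Σ ℕ λ hi → Σ ℕ λ h →
  Residue M W × W ≡ lo + 2 ^ (suc M * V) * (1 + 2 * h + base M * hi) ×
  lo < 2 ^ (suc M * V) × 1 + 2 * h < base M

oddBin⁻ : ∀ M V → OddBin M V → bin₂ M V ≡ true
oddBin⁻ M V (W , lo , hi , h , r , e , lo< , h<) with binomial-digit-< (base M) M V (^-monoʳ-< 2 (s≤s (s≤s z≤n)) (n<1+n M))
... | lo′ , hi′ , e′ , lo′< =
  trans (sym (odd-bin M V)) (trans (cong odd (sym (proj₁ digit))) (odd-1+2* h))
  where
  p≡ : 2 ^ (suc M * V) ≡ base M ^ V
  p≡ = sym (^-*-assoc 2 (suc M) V)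
  digit : 1 + 2 * h ≡ bin M V × hi ≡ hi′
  digit = quotient-unique (base M) hi hi′ h<
    (≤-<-trans (bin-≤ M V) (^-monoʳ-< 2 (s≤s (s≤s z≤n)) (n<1+n M)))
    (proj₂ (quotient-unique (base M ^ V) _ _ (subst (lo <_) p≡ lo<) lo′<
      (trans (cong (λ p → lo + p * (1 + 2 * h + base M * hi)) (sym p≡))
        (trans (sym e) (trans (residue⁻ M W r) e′)))))

oddBin⁺ : ∀ M V → bin₂ M V ≡ true → OddBin M V
oddBin⁺ M V b with binomial-digit-< (base M) M V (^-monoʳ-< 2 (s≤s (s≤s z≤n)) (n<1+n M)) | odd-witness (bin M V) (trans (odd-bin M V) b)
... | lo , hi , e , lo< | h , e′ =
  (1 + base M) ^ M , lo , hi , h , residue⁺ M ,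
  trans e (cong₂ (λ p c → lo + p * (c + base M * hi)) p≡ e′) ,
  subst (lo <_) p≡ lo< ,
  ≤-<-trans (≤-reflexive (sym e′)) (≤-<-trans (bin-≤ M V) (^-monoʳ-< 2 (s≤s (s≤s z≤n)) (n<1+n M)))
  where
  p≡ : base M ^ V ≡ 2 ^ (suc M * V)
  p≡ = ^-*-assoc 2 (suc M) V

oddBin : ∀ {n} {M V : Env n → ℕ} → Tm exp M → Tm exp V → Dio exp (λ ρ → bin₂ (M ρ) (V ρ) ≡ true)
oddBin {M = M} {V} M′ V′ = iff (λ ρ → oddBin⁻ (M ρ) (V ρ)) (λ ρ → oddBin⁺ (M ρ) (V ρ))
  (ex (ex (ex (ex (residue M″ (pop (pop (pop top))) ∧
    pop (pop (pop top)) ≐ pop (pop top) ⊕ two^ ((con 1 ⊕ M″) ⊛ V″) ⊛ (con 1 ⊕ con 2 ⊛ top ⊕ two^ (con 1 ⊕ M″) ⊛ pop top) ∧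
    pop (pop top) ≺ two^ ((con 1 ⊕ M″) ⊛ V″) ∧
    con 1 ⊕ con 2 ⊛ top ≺ two^ (con 1 ⊕ M″))))))
  where
  M″ = pop (pop (pop (pop M′)))
  V″ = pop (pop (pop (pop V′)))

-- The base leaves `d + 1` spare bits above digits of `c` bits. With `d` equal to `c` there is room
-- for the sum and the product of two digits; larger `d` give the auxiliary bases of `Product`.
Digits : ℕ → ℕ → ℕ → ℕ → Set
Digits c d T V = Σ (ℕ → ℕ) λ v → (∀ t → t < T → v t < 2 ^ c) × V ≡ rep (2 ^ suc (c + d)) v T

-- The mask M is determined by M * (B ∸ 1) ≡ (2 ^ c ∸ 1) * (B ^ T ∸ 1).
Mask : ℕ → ℕ → ℕ → ℕ → Set
Mask c d T M = M * 2 ^ suc (c + d) + (2 ^ c + 2 ^ (suc (c + d) * T)) ≡ M + (2 ^ c * 2 ^ (suc (c + d) * T) + 1)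

mask⁺ : ∀ c d T → Mask c d T (rep (2 ^ suc (c + d)) (λ _ → mask c) T)
mask⁺ c d T = subst₂ (λ p q → M * B + (p + q) ≡ M + (p * q + 1)) (suc-mask c) (^-*-assoc 2 (suc (c + d)) T) (go T)
  where
  B = 2 ^ suc (c + d)
  M = rep B (λ _ → mask c) T
  go : ∀ T → rep B (λ _ → mask c) T * B + (suc (mask c) + B ^ T) ≡ rep B (λ _ → mask c) T + (suc (mask c) * B ^ T + 1)
  go zero = lem (mask c)
    where lem : ∀ e → suc e + 1 ≡ suc e * 1 + 1
          lem = solve-∀
  go (suc T) = +-cancelʳ-≡ (B * suc (mask c)) _ _
    (trans (lem (mask c) B R (B ^ T)) (trans (cong (λ p → mask c * B + suc (mask c) + B * p) (go T)) (lem′ (mask c) B R (B ^ T))))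
    where
    R = rep B (λ _ → mask c) T
    lem : ∀ e B R p → (e + B * R) * B + (suc e + B * p) + B * suc e ≡ e * B + suc e + B * (R * B + (suc e + p))
    lem = solve-∀
    lem′ : ∀ e B R p → e * B + suc e + B * (R + (suc e * p + 1)) ≡ e + B * R + (suc e * (B * p) + 1) + B * suc e
    lem′ = solve-∀

-- The equation is `M * (B ∸ 1) ≡ D ∸ A` with the subtractions moved across, and `B ∸ 1` can be
-- cancelled.
affine-unique : ∀ B M M′ A D → 1 < B → M * B + A ≡ M + D → M′ * B + A ≡ M′ + D → M ≡ M′
affine-unique (suc (suc K)) M M′ A D (s≤s (s≤s _)) e e′ = *-cancelʳ-≡ M M′ (suc K)
  (+-cancelʳ-≡ (M + M′ + A + D) _ _ (trans (lem M M′ A D K) (trans (cong₂ _+_ e (sym e′)) (lem′ M M′ A D K))))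
  where
  lem : ∀ M M′ A D K → M * suc K + (M + M′ + A + D) ≡ (M * suc (suc K) + A) + (M′ + D)
  lem = solve-∀
  lem′ : ∀ M M′ A D K → (M + D) + (M′ * suc (suc K) + A) ≡ M′ * suc K + (M + M′ + A + D)
  lem′ = solve-∀

1<2^suc : ∀ b → 1 < 2 ^ suc b
1<2^suc b = *-monoʳ-≤ 2 (0<2^ b)

digits : ∀ {n} {c d T V : Env n → ℕ} → Tm exp c → Tm exp d → Tm exp T → Tm exp V →
  Dio exp (λ ρ → Digits (c ρ) (d ρ) (T ρ) (V ρ))
digits {c = c} {d} {T} {V} c′ d′ T′ V′ = iff
  (λ ρ (M , m , o) → bin₂-rep⁻ (suc (c ρ + d ρ)) (c ρ) (T ρ) (V ρ) (c≤ (c ρ) (d ρ))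
    (subst (λ M → bin₂ M (V ρ) ≡ true) (affine-unique _ M _ _ _ (1<2^suc (c ρ + d ρ)) m (mask⁺ (c ρ) (d ρ) (T ρ))) o))
  (λ ρ (v , v< , e) → _ , mask⁺ (c ρ) (d ρ) (T ρ) ,
    subst (λ V → bin₂ _ V ≡ true) (sym e) (bin₂-rep⁺ (suc (c ρ + d ρ)) (c ρ) (T ρ) v (c≤ (c ρ) (d ρ)) v<))
  (ex (top ⊛ two^ b ⊕ (two^ (pop c′) ⊕ two^ (b ⊛ pop T′)) ≐
       top ⊕ (two^ (pop c′) ⊛ two^ (b ⊛ pop T′) ⊕ con 1) ∧
       oddBin top (pop V′)))
  where
  b = con 1 ⊕ (pop c′ ⊕ pop d′)
  c≤ : ∀ c d → c ≤ suc (c + d)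
  c≤ c d = m≤n⇒m≤1+n (m≤m+n c d)

-- Digitwise multiplication.

Below : ℕ → ℕ → (ℕ → ℕ) → Set
Below K T f = ∀ t → t < T → f t < K

below-tail : ∀ {K T f} → Below K (suc T) f → Below K T (f ∘ suc)
below-tail h t lt = h (suc t) (s≤s lt)

-- Digit `t` has weight `W ^ (T ∸ 1 ∸ t)` here and `W ^ t` in `rep`, so in a product digits of equal
-- index meet at one power of `W`. In `hadamard`, reading `f` in base `B * W` leaves the weight
-- `B ^ t` on these products, and the extra factor `W` moves the common power to `W ^ T`.
revrep : ℕ → (ℕ → ℕ) → ℕ → ℕ
revrep W g zero = 0
revrep W g (suc T) = g 0 * W ^ T + revrep W (g ∘ suc) T

revrep-≤ : ∀ K W T g → K ≤ W → Below K T g → revrep W g T * W ≤ K * W ^ T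
revrep-≤ K W zero g K≤W h = z≤n
revrep-≤ K W (suc T) g K≤W h = begin
  (g 0 * W ^ T + revrep W (g ∘ suc) T) * W      ≡⟨ *-distribʳ-+ W (g 0 * W ^ T) _ ⟩
  g 0 * W ^ T * W + revrep W (g ∘ suc) T * W    ≤⟨ +-monoʳ-≤ _ (revrep-≤ K W T (g ∘ suc) K≤W (below-tail h)) ⟩
  g 0 * W ^ T * W + K * W ^ T                   ≤⟨ +-monoʳ-≤ _ (*-monoˡ-≤ (W ^ T) K≤W) ⟩
  g 0 * W ^ T * W + W * W ^ T                   ≡⟨ lem (g 0) (W ^ T) W ⟩
  suc (g 0) * (W * W ^ T)                       ≤⟨ *-monoˡ-≤ (W * W ^ T) (h 0 (s≤s z≤n)) ⟩
  K * (W * W ^ T) ∎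
  where
  open ≤-Reasoning
  lem : ∀ a p W → a * p * W + W * p ≡ suc a * (W * p)
  lem = solve-∀

-- The coefficient of W ^ T collects the products f t * g t, with the weights B ^ t.
hadamard : ∀ K B W T f g → K * K ≤ B → K ≤ W → 0 < B → Below K T f → Below K T g →
  Σ ℕ λ lo → Σ ℕ λ hi →
  W * (rep (B * W) f T * revrep W g T) ≡ lo + W ^ T * (rep B (λ t → f t * g t) T + W * hi) ×
  lo * W ≤ T * B ^ T * W ^ T
hadamard K B W zero f g KK K≤W 0<B hf hg = 0 , 0 , lem W , z≤n
  where lem : ∀ W → W * (0 * 0) ≡ 0 + 1 * (0 + W * 0)
        lem = solve-∀
hadamard K B W (suc T) f g KK K≤W 0<B hf hg
  with hadamard K B W T (f ∘ suc) (g ∘ suc) KK K≤W 0<B (below-tail hf) (below-tail hg)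
-- The digit `f 0` against the later digits of `g` lands below the power `W ^ suc T`, and `g 0`
-- against those of `f` above it; the rest is shifted by `B * W`.
... | lo , hi , e , b = W * (f 0 * Y) + B * W * lo , B * X * g 0 + B * hi ,
  trans (lem W (f 0) B X (g 0) (W ^ T) Y) (trans
    (cong (λ p → W * f 0 * g 0 * W ^ T + W * f 0 * Y + W * B * W * X * g 0 * W ^ T + B * W * p) e)
    (lem′ W (f 0) B X (g 0) (W ^ T) Y lo hi _)) ,
  (begin
    (W * (f 0 * Y) + B * W * lo) * W                      ≡⟨ lem₁ W (f 0) Y B lo ⟩
    W * f 0 * (Y * W) + B * W * (lo * W)                
      ≤⟨ +-mono-≤ (*-monoʳ-≤ (W * f 0) (revrep-≤ K W T (g ∘ suc) K≤W (below-tail hg))) (*-monoʳ-≤ (B * W) b) ⟩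
    W * f 0 * (K * W ^ T) + B * W * (T * B ^ T * W ^ T)   ≡⟨ lem₂ W (f 0) K (W ^ T) B T (B ^ T) ⟩
    f 0 * K * 1 * (W * W ^ T) + T * (B * B ^ T) * (W * W ^ T)
      ≤⟨ +-monoˡ-≤ _ (*-monoˡ-≤ (W * W ^ T) (*-mono-≤ (≤-trans (*-monoˡ-≤ K (<⇒≤ (hf 0 (s≤s z≤n)))) KK) (m^n>0 B {{>-nonZero 0<B}} T))) ⟩
    B * B ^ T * (W * W ^ T) + T * (B * B ^ T) * (W * W ^ T) ≡⟨ lem₃ (B * B ^ T) (W * W ^ T) T ⟩
    suc T * (B * B ^ T) * (W * W ^ T) ∎)
  where
  open ≤-Reasoning
  X = rep (B * W) (f ∘ suc) T
  Y = revrep W (g ∘ suc) T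
  lem : ∀ W a B X b p Y → W * ((a + B * W * X) * (b * p + Y)) ≡
    W * a * b * p + W * a * Y + W * B * W * X * b * p + B * W * (W * (X * Y))
  lem = solve-∀
  lem′ : ∀ W a B X b p Y lo hi z →
    W * a * b * p + W * a * Y + W * B * W * X * b * p + B * W * (lo + p * (z + W * hi)) ≡
    W * (a * Y) + B * W * lo + W * p * (a * b + B * z + W * (B * X * b + B * hi))
  lem′ = solve-∀
  lem₁ : ∀ W a Y B lo → (W * (a * Y) + B * W * lo) * W ≡ W * a * (Y * W) + B * W * (lo * W)
  lem₁ = solve-∀
  lem₂ : ∀ W a K p B T q → W * a * (K * p) + B * W * (T * q * p) ≡ a * K * 1 * (W * p) + T * (B * q) * (W * p)
  lem₂ = solve-∀
  lem₃ : ∀ b w T → b * w + T * b * w ≡ suc T * b * w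
  lem₃ = solve-∀

-- The two bases differ by `m`, so the two numerals agree modulo `m`.
rep-mod : ∀ m B f T → Σ ℕ λ q → rep (m + B) f T ≡ rep B f T + m * q
rep-mod m B f zero = 0 , sym (*-zeroʳ m)
rep-mod m B f (suc T) with rep-mod m B (f ∘ suc) T
... | q , e = rep B (f ∘ suc) T + (m + B) * q ,
  trans (cong (λ r → f 0 + (m + B) * r) e) (lem (f 0) m B (rep B (f ∘ suc) T) q)
  where lem : ∀ a m B r q → a + (m + B) * (r + m * q) ≡ a + B * r + m * (r + (m + B) * q)
        lem = solve-∀

-- Modulo `m`, which is `B * W ∸ 1`, the base `W` is inverse to `B`. Multiplication by `B ^ T` thus
-- turns the weight `W ^ (T ∸ 1 ∸ t)` into `B * B ^ t`, which undoes the reversal.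
revrep-mod : ∀ m B W g T → B * W ≡ suc m → Σ ℕ λ q → B ^ T * revrep W g T ≡ B * rep B g T + m * q
revrep-mod m B W g zero e = 0 , lem B m
  where lem : ∀ B m → 1 * 0 ≡ B * 0 + m * 0
        lem = solve-∀
revrep-mod m B W g (suc T) e with revrep-mod m B W (g ∘ suc) T e | power-mod m 1 T
... | q , ih | r , er = B * g 0 * r + B * q , (begin
  B * B ^ T * (g 0 * W ^ T + Y)                  ≡⟨ lem B (B ^ T) (g 0) (W ^ T) Y ⟩
  B * g 0 * (B ^ T * W ^ T) + B * (B ^ T * Y)    ≡⟨ cong₂ (λ p s → B * g 0 * p + B * s) pow-ih ih ⟩
  B * g 0 * (1 + m * r) + B * (B * R + m * q)    ≡⟨ lem′ B (g 0) m r R q ⟩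
  B * (g 0 + B * R) + m * (B * g 0 * r + B * q) ∎)
  where
  open ≡-Reasoning
  Y = revrep W (g ∘ suc) T
  R = rep B (g ∘ suc) T
  ^-distribʳ : ∀ T → B ^ T * W ^ T ≡ (B * W) ^ T
  ^-distribʳ zero = refl
  ^-distribʳ (suc T) = trans (swap B (B ^ T) W (W ^ T)) (cong (B * W *_) (^-distribʳ T))
    where swap : ∀ a b c d → a * b * (c * d) ≡ a * c * (b * d)
          swap = solve-∀
  pow-ih : B ^ T * W ^ T ≡ 1 + m * r
  pow-ih = trans (^-distribʳ T) (trans (cong (_^ T) (trans e (+-comm 1 m)))
    (trans er (cong (_+ m * r) (^-zeroˡ T))))
  lem : ∀ B p a w Y → B * p * (a * w + Y) ≡ B * a * (p * w) + B * (p * Y)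
  lem = solve-∀
  lem′ : ∀ B a m r R q → B * a * (1 + m * r) + B * (B * R + m * q) ≡ B * (a + B * R) + m * (B * a * r + B * q)
  lem′ = solve-∀

-- `Digits` speaks of the usual order; the reversed list is what `hadamard` expects.
toReverse : ∀ K W T f → Below K T f → Σ (ℕ → ℕ) λ g → Below K T g × rep W f T ≡ revrep W g T
toReverse K W zero f h = f , h , refl
toReverse K W (suc T) f h with toReverse K W T f (λ t lt → h t (m<n⇒m<1+n lt))
... | g , hg , e = (f T ◂ g) , (λ { zero _ → h T (n<1+n T) ; (suc t) (s≤s lt) → hg t lt }) ,
  trans (rep-snoc W f T) (trans (cong₂ _+_ e (*-comm (W ^ T) (f T))) (+-comm (revrep W g T) _))

∸-step : ∀ T t → t < T → T ∸ t ≡ suc (T ∸ suc t)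
∸-step (suc T) zero lt = refl
∸-step (suc T) (suc t) (s≤s lt) = ∸-step T t lt

revrep-rep : ∀ W g T → revrep W g T ≡ rep W (λ t → g (T ∸ suc t)) T
revrep-rep W g zero = refl
revrep-rep W g (suc T) = begin
  g 0 * W ^ T + revrep W (g ∘ suc) T                  ≡⟨ cong₂ _+_ (*-comm (g 0) (W ^ T)) (revrep-rep W (g ∘ suc) T) ⟩
  W ^ T * g 0 + rep W (λ t → g (suc (T ∸ suc t))) T   ≡⟨ +-comm (W ^ T * g 0) _ ⟩
  rep W (λ t → g (suc (T ∸ suc t))) T + W ^ T * g 0
    ≡⟨ cong₂ (λ r a → r + W ^ T * g a) (rep-cong W T (λ t lt → cong g (sym (∸-step T t lt)))) (sym (n∸n≡0 T)) ⟩
  rep W (λ t → g (T ∸ t)) T + W ^ T * g (T ∸ T)       ≡⟨ rep-snoc W (λ t → g (T ∸ t)) T ⟨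
  rep W (λ t → g (T ∸ t)) (suc T) ∎
  where open ≡-Reasoning

module _ (B m T : ℕ) (k : ℕ) where

  -- A list of digits is determined by its value in base B, which bounds m from below.
  rebase-unique : ∀ f f′ → B ^ T ≤ m → Below B T f → Below B T f′ →
    rep (m + B) f′ T + k * B ≡ rep B f T + k * (m + B) → ∀ t → t < T → f′ t ≡ f t
  rebase-unique f f′ B≤ hf hf′ e with rep-mod m B f′ T
  ... | q , ih = rep-unique B T hf′ hf
    (proj₁ (quotient-unique m q k (<-≤-trans (rep-< B T hf′) B≤) (<-≤-trans (rep-< B T hf) B≤)
      (+-cancelʳ-≡ (k * B) _ _ (trans (cong (_+ k * B) (sym ih)) (trans e (lem (rep B f T) k m B))))))
    where lem : ∀ r k m B → r + k * (m + B) ≡ r + m * k + k * B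
          lem = solve-∀

  reverse-unique : ∀ W g g′ → B * W ≡ suc m → B * B ^ T ≤ m → 0 < B → Below B T g → Below B T g′ →
    B ^ T * revrep W g′ T + k ≡ B * rep B g T + k * (B * W) → ∀ t → t < T → g′ t ≡ g t
  reverse-unique W g g′ BW≡ B≤ 0<B hg hg′ e with revrep-mod m B W g′ T BW≡
  ... | q , ih = rep-unique B T hg′ hg
    (*-cancelˡ-≡ _ _ B {{>-nonZero 0<B}} (proj₁ (quotient-unique m q k (small hg′) (small hg)
      (+-cancelʳ-≡ k _ _ (trans (cong (_+ k) (sym ih)) (trans e (trans (cong (λ p → B * rep B g T + k * p) BW≡) (lem (B * rep B g T) k m))))))))
    where
    lem : ∀ r k m → r + k * suc m ≡ r + m * k + k
    lem = solve-∀
    small : ∀ {g} → Below B T g → B * rep B g T < m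
    small h = <-≤-trans (*-monoʳ-< B {{>-nonZero 0<B}} (rep-< B T h)) B≤

width : ℕ → ℕ
width c = suc (c + c)

radix : ℕ → ℕ
radix c = 2 ^ width c

-- Bases W = 2 ^ suc (c + excess₁ c T) and B * W = 2 ^ suc (c + excess₂ c T), in the notation of hadamard.
excess₁ excess₂ : ℕ → ℕ → ℕ
excess₁ c T = T + width c * T + width c
excess₂ c T = c + suc (c + excess₁ c T)

-- With `B` for `radix c`, `X^` is the list of `X` in base `B * W` and `Y^` that of `Y` reversed in
-- base `W`. The congruences modulo `B * W ∸ B` and `B * W ∸ 1`, with quotients `k` and `j`, tie
-- them to the numerals in base `B`. Then `Z` is the digit at `W ^ T`.
Product : ℕ → ℕ → ℕ → ℕ → ℕ → Set
Product c T X Y Z = Σ ℕ λ X^ → Σ ℕ λ Y^ → Σ ℕ λ k → Σ ℕ λ j → Σ ℕ λ lo → Σ ℕ λ hi →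
  Digits c (excess₂ c T) T X^ × Digits c (excess₁ c T) T Y^ ×
  X^ + k * 2 ^ width c ≡ X + k * 2 ^ suc (c + excess₂ c T) ×
  2 ^ (width c * T) * Y^ + j ≡ 2 ^ width c * Y + j * (2 ^ width c * 2 ^ suc (c + excess₁ c T)) ×
  2 ^ suc (c + excess₁ c T) * (X^ * Y^) ≡ lo + 2 ^ (suc (c + excess₁ c T) * T) * (Z + 2 ^ suc (c + excess₁ c T) * hi) ×
  lo < 2 ^ (suc (c + excess₁ c T) * T) × Z < 2 ^ suc (c + excess₁ c T)

product : ∀ {n} {c T X Y Z : Env n → ℕ} → Tm exp c → Tm exp T → Tm exp X → Tm exp Y → Tm exp Z →
  Dio exp (λ ρ → Product (c ρ) (T ρ) (X ρ) (Y ρ) (Z ρ))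
product c T X Y Z = ex (ex (ex (ex (ex (ex (
  digits c′ e₂ T′ X^ ∧ digits c′ e₁ T′ Y^ ∧
  X^ ⊕ k ⊛ two^ w ≐ w6 X ⊕ k ⊛ two^ (con 1 ⊕ (c′ ⊕ e₂)) ∧
  two^ (w ⊛ T′) ⊛ Y^ ⊕ j ≐ two^ w ⊛ w6 Y ⊕ j ⊛ (two^ w ⊛ two^ u) ∧
  two^ u ⊛ (X^ ⊛ Y^) ≐ lo ⊕ two^ (u ⊛ T′) ⊛ (w6 Z ⊕ two^ u ⊛ hi) ∧
  lo ≺ two^ (u ⊛ T′) ∧ w6 Z ≺ two^ u))))))
  where
  w6 : ∀ {n} {f : Env n → ℕ} → Tm exp f → Tm exp {suc (suc (suc (suc (suc (suc n)))))} (λ ρ → f (proj₂ (proj₂ (proj₂ (proj₂ (proj₂ (proj₂ ρ)))))))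
  w6 t = pop (pop (pop (pop (pop (pop t)))))
  c′ = w6 c
  T′ = w6 T
  w = con 1 ⊕ (c′ ⊕ c′)
  e₁ = T′ ⊕ w ⊛ T′ ⊕ w
  u = con 1 ⊕ (c′ ⊕ e₁)
  e₂ = c′ ⊕ u
  hi = top
  lo = pop top
  j = pop (pop top)
  k = pop (pop (pop top))
  Y^ = pop (pop (pop (pop top)))
  X^ = pop (pop (pop (pop (pop top))))

Represents : ℕ → ℕ → ℕ → (ℕ → ℕ) → Set
Represents c T X f = Below (2 ^ c) T f × X ≡ rep (radix c) f T

module _ (c T : ℕ) where
  private
    B = radix c
    e = excess₁ c T
    W = 2 ^ suc (c + e)
    V = 2 ^ suc (c + excess₂ c T)

  2^c*2^c<B : 2 ^ c * 2 ^ c < B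
  2^c*2^c<B = subst (_< B) (^-distribˡ-+-* 2 c c) (^-monoʳ-< 2 (s≤s (s≤s z≤n)) (n<1+n (c + c)))

  2^c+2^c≤B : 2 ^ c + 2 ^ c ≤ B
  2^c+2^c≤B = subst (_≤ B) (lem (2 ^ c)) (^-monoʳ-≤ 2 (s≤s (m≤m+n c c)))
    where lem : ∀ p → 2 * p ≡ p + p
          lem = solve-∀

  2^c<B : 2 ^ c < B
  2^c<B = ^-monoʳ-< 2 (s≤s (s≤s z≤n)) (s≤s (m≤m+n c c))

  below-radix : ∀ {f} → Below (2 ^ c) T f → Below B T f
  below-radix h t lt = <-trans (h t lt) 2^c<B

  private
    V≡ : V ≡ B * W
    V≡ = trans (cong (2 ^_) (cong suc (sym (+-assoc c c (suc (c + e)))))) (^-distribˡ-+-* 2 (suc (c + c)) (suc (c + e)))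

    BT≡ : 2 ^ (width c * T) ≡ B ^ T
    BT≡ = sym (^-*-assoc 2 (width c) T)

    WT≡ : 2 ^ (suc (c + e) * T) ≡ W ^ T
    WT≡ = sym (^-*-assoc 2 (suc (c + e)) T)

    2^c≤W : 2 ^ c ≤ W
    2^c≤W = ^-monoʳ-≤ 2 (m≤n⇒m≤1+n (m≤m+n c e))

    0<B : 0 < B
    0<B = 0<2^ (width c)

    e<W : 2 ^ e < W
    e<W = ^-monoʳ-< 2 (s≤s (s≤s z≤n)) (s≤s (m≤n+m e c))

    -- The three summands of the excess are the exponents of `2 ^ T`, `B ^ T` and `B`; the first
    -- dominates the factor `T` in the bound on `lo`.
    TB<W : T * B ^ T * B < W
    TB<W = ≤-<-trans (begin
      T * B ^ T * B                            ≤⟨ *-monoˡ-≤ B (*-monoˡ-≤ (B ^ T) (<⇒≤ (n<2^n T))) ⟩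
      2 ^ T * B ^ T * B                        ≡⟨ cong (λ p → 2 ^ T * p * B) BT≡ ⟨
      2 ^ T * 2 ^ (width c * T) * B            ≡⟨ cong (_* B) (^-distribˡ-+-* 2 T _) ⟨
      2 ^ (T + width c * T) * B                ≡⟨ ^-distribˡ-+-* 2 (T + width c * T) (width c) ⟨
      2 ^ e ∎) e<W
      where
      open ≤-Reasoning

    BTB<W : B ^ T * B < W
    BTB<W = ≤-<-trans (begin
      B ^ T * B                                ≡⟨ cong (_* B) BT≡ ⟨
      2 ^ (width c * T) * B                    ≡⟨ ^-distribˡ-+-* 2 (width c * T) (width c) ⟨
      2 ^ (width c * T + width c)              ≤⟨ ^-monoʳ-≤ 2 (+-monoˡ-≤ (width c) (m≤n+m _ T)) ⟩
      2 ^ e ∎) e<W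
      where open ≤-Reasoning

    BT<W : B ^ T < W
    BT<W = ≤-<-trans (m≤m*n (B ^ T) B {{>-nonZero 0<B}}) BTB<W

    m₁ m₂ : ℕ
    m₁ = V ∸ B
    m₂ = (B * W) ∸ 1

    V≡m₁+B : V ≡ m₁ + B
    V≡m₁+B = sym (m∸n+n≡m (subst (B ≤_) (sym V≡) (m≤m*n B W {{>-nonZero (0<2^ (suc (c + e)))}})))

    BW≡ : B * W ≡ suc m₂
    BW≡ = trans (sym (m∸n+n≡m (*-mono-≤ 0<B (0<2^ (suc (c + e)))))) (+-comm m₂ 1)

    B^T≤m₁ : B ^ T ≤ m₁
    B^T≤m₁ = +-cancelʳ-≤ B _ _ (begin
      B ^ T + B          ≤⟨ +-monoˡ-≤ B (m≤n*m (B ^ T) B {{>-nonZero 0<B}}) ⟩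
      B * B ^ T + B      ≡⟨ +-comm (B * B ^ T) B ⟩
      B + B * B ^ T      ≡⟨ *-suc B (B ^ T) ⟨
      B * suc (B ^ T)    ≤⟨ *-monoʳ-≤ B BT<W ⟩
      B * W              ≡⟨ V≡ ⟨
      V                  ≡⟨ V≡m₁+B ⟩
      m₁ + B ∎)
      where open ≤-Reasoning

    BB^T≤m₂ : B * B ^ T ≤ m₂
    BB^T≤m₂ = ≤-pred (subst (B * B ^ T <_) BW≡ (*-monoʳ-< B {{>-nonZero 0<B}} BT<W))

    had = λ f g → hadamard (2 ^ c) B W T f g (<⇒≤ 2^c*2^c<B) 2^c≤W 0<B

    lo< : ∀ {lo} → lo * W ≤ T * B ^ T * W ^ T → lo < W ^ T
    lo< {lo} h = *-cancelʳ-< W lo (W ^ T) (≤-<-trans h (begin-strict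
      T * B ^ T * W ^ T    ≤⟨ *-monoˡ-≤ (W ^ T) (m≤m*n (T * B ^ T) B {{>-nonZero 0<B}}) ⟩
      T * B ^ T * B * W ^ T <⟨ *-monoˡ-< (W ^ T) {{>-nonZero (m^n>0 W {{>-nonZero (0<2^ (suc (c + e)))}} T)}} TB<W ⟩
      W * W ^ T            ≡⟨ *-comm W (W ^ T) ⟩
      W ^ T * W ∎))
      where open ≤-Reasoning

    below-product : ∀ {f g} → Below (2 ^ c) T f → Below (2 ^ c) T g → Below B T (λ t → f t * g t)
    below-product hf hg t lt = ≤-<-trans (*-mono-≤ (<⇒≤ (hf t lt)) (<⇒≤ (hg t lt))) 2^c*2^c<B

  product⁻ : ∀ {X Y Z f g} → Represents c T X f → Represents c T Y g → Product c T X Y Z →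
    Z ≡ rep B (λ t → f t * g t) T
  product⁻ {Z = Z} {f} {g} (hf , refl) (hg , refl)
    (_ , _ , k , j , lo , hi , (f′ , hf′ , refl) , (g″ , hg″ , refl) , ef , eg , e* , lo<W , Z<W)
    with toReverse (2 ^ c) W T g″ hg″
  ... | g′ , hg′ , er rewrite er
    with had f g hf hg
  ... | lo′ , hi′ , e′ , b′ =
    proj₁ (quotient-unique W hi hi′ Z<W (<-trans (rep-< B T (below-product hf hg)) BT<W)
      (proj₂ (quotient-unique (W ^ T) _ _ (subst (lo <_) WT≡ lo<W) (lo< b′) (begin
        lo + W ^ T * (Z + W * hi)                         ≡⟨ cong (λ p → lo + p * (Z + W * hi)) WT≡ ⟨
        lo + 2 ^ (suc (c + e) * T) * (Z + W * hi)         ≡⟨ e* ⟨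
        W * (rep V f′ T * revrep W g′ T)
          ≡⟨ cong₂ (λ p q → W * (p * q)) (trans (rep-cong V T f≗) (cong (λ v → rep v f T) V≡))
               (trans (revrep-rep W g′ T) (trans (rep-cong W T (λ t lt → g≗ (T ∸ suc t) (∸-< lt))) (sym (revrep-rep W g T)))) ⟩
        W * (rep (B * W) f T * revrep W g T)              ≡⟨ e′ ⟩
        lo′ + W ^ T * (rep B (λ t → f t * g t) T + W * hi′) ∎))))
    where
    open ≡-Reasoning
    ∸-< : ∀ {t} → t < T → T ∸ suc t < T
    ∸-< {t} lt = subst (_≤ T) (∸-step T t lt) (m∸n≤m T t)
    f≗ : ∀ t → t < T → f′ t ≡ f t
    f≗ = rebase-unique B m₁ T k f f′ B^T≤m₁ (below-radix hf) (below-radix hf′)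
      (subst (λ v → rep v f′ T + k * B ≡ rep B f T + k * v) V≡m₁+B ef)
    g≗ : ∀ t → t < T → g′ t ≡ g t
    g≗ = reverse-unique B m₂ T j W g g′ BW≡ BB^T≤m₂ 0<B (below-radix hg) (below-radix hg′)
      (subst (λ p → p * revrep W g′ T + j ≡ B * rep B g T + j * (B * W)) BT≡ eg)

  product⁺ : ∀ {X Y f g} → Represents c T X f → Represents c T Y g →
    Product c T X Y (rep B (λ t → f t * g t) T)
  product⁺ {f = f} {g} (hf , refl) (hg , refl)
    with rep-mod m₁ B f T | revrep-mod m₂ B W g T BW≡ | had f g hf hg
  ... | k , ek | j , ej | lo , hi , e′ , b′ =
    rep V f T , revrep W g T , k , j , lo , hi , (f , hf , refl) ,
    ((λ t → g (T ∸ suc t)) , (λ t lt → hg (T ∸ suc t) (subst (_≤ T) (∸-step T t lt) (m∸n≤m T t))) , revrep-rep W g T) ,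
    trans (cong (_+ k * B) (trans (cong (λ v → rep v f T) V≡m₁+B) ek))
      (trans (lem (rep B f T) m₁ k B) (cong (λ v → rep B f T + k * v) (sym V≡m₁+B))) ,
    trans (cong (λ p → p * revrep W g T + j) BT≡) (trans (cong (_+ j) ej)
      (trans (lem′ (B * rep B g T) m₂ j) (cong (λ v → B * rep B g T + j * v) (sym BW≡)))) ,
    trans (cong (λ v → W * (rep v f T * revrep W g T)) V≡)
      (trans e′ (cong (λ p → lo + p * (rep B (λ t → f t * g t) T + W * hi)) (sym WT≡))) ,
    subst (lo <_) (sym WT≡) (lo< b′) ,
    <-trans (rep-< B T (below-product hf hg)) BT<W
    where
    lem : ∀ r m k B → r + m * k + k * B ≡ r + k * (m + B)
    lem = solve-∀
    lem′ : ∀ r m j → r + m * j + j ≡ r + j * suc m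
    lem′ = solve-∀

-- Imposing a polynomial relation on all digits.

infixr 5 _∷_

data Sub {N} : ∀ {n} → (Env N → Env n) → Set where
  []  : Sub {n = 0} (λ _ → tt)
  _∷_ : ∀ {n} {f : Env N → ℕ} {X : Env N → Env n} → Tm exp f → Sub X → Sub (λ ρ → f ρ , X ρ)

weaken : ∀ {N n} {X : Env N → Env n} → Sub X → Sub (λ ρ → X (proj₂ ρ))
weaken [] = []
weaken (t ∷ s) = pop t ∷ weaken s

head : ∀ {N n} {X : Env N → Env (suc n)} → Sub X → Tm exp (proj₁ ∘ X)
head (t ∷ s) = t

tail : ∀ {N n} {X : Env N → Env (suc n)} → Sub X → Sub (proj₂ ∘ X)
tail (t ∷ s) = s

Represent : ∀ c T {n} → Env n → (ℕ → Env n) → Set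
Represent c T {zero} X xs = ⊤
Represent c T {suc n} X xs = Represents c T (proj₁ X) (proj₁ ∘ xs) × Represent c T (proj₂ X) (proj₂ ∘ xs)

bounded : ∀ T h → Σ ℕ λ c₀ → ∀ {c} → c₀ ≤ c → Below (2 ^ c) T h
bounded zero h = 0 , λ _ _ ()
bounded (suc T) h with bounded T (h ∘ suc)
... | c₀ , H = h 0 ⊔ c₀ , λ { le zero _ → <-≤-trans (n<2^n (h 0)) (^-monoʳ-≤ 2 (m⊔n≤o⇒m≤o (h 0) c₀ le))
                            ; le (suc t) (s≤s lt) → H (m⊔n≤o⇒n≤o (h 0) c₀ le) t lt }

-- Sums and products of digits below `2 ^ c` stay below the radix, so no carries occur. `Digits`
-- then puts the results below `2 ^ c` again, ready for the next operation.
digits-below : ∀ c T {Z h} → Below (radix c) T h → Z ≡ rep (radix c) h T → Digits c c T Z → Below (2 ^ c) T h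
digits-below c T hB refl (v , hv , e) t lt =
  subst (_< 2 ^ c) (sym (rep-unique (radix c) T hB (below-radix c T hv) e t lt)) (hv t lt)

-- Rel describes terms digit by digit.  It is sound for every digit size c, but complete
-- only for large c, as all intermediate values have to stay below 2 ^ c.
record LiftTm {n} (f : Env n → ℕ) : Set₁ where
  field
    Rel      : ℕ → ℕ → Env n → ℕ → Set
    dio      : ∀ {N} {c T : Env N → ℕ} {X : Env N → Env n} {Z : Env N → ℕ} →
               Tm exp c → Tm exp T → Sub X → Tm exp Z → Dio exp (λ ρ → Rel (c ρ) (T ρ) (X ρ) (Z ρ))
    sound    : ∀ c T {X Z xs} → Represent c T X xs → Rel c T X Z → Represents c T Z (f ∘ xs)
    complete : ∀ T xs → Σ ℕ λ c₀ → ∀ {c X} → c₀ ≤ c → Represent c T X xs → Rel c T X (rep (radix c) (f ∘ xs) T)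

-- A geometric sum, with the subtractions cleared.
constant : ∀ k c T → rep (radix c) (λ _ → k) T * radix c + k ≡ rep (radix c) (λ _ → k) T + k * 2 ^ (width c * T)
constant k c T = trans (go T) (cong (λ p → rep (radix c) (λ _ → k) T + k * p) (^-*-assoc 2 (width c) T))
  where
  B = radix c
  go : ∀ T → rep B (λ _ → k) T * B + k ≡ rep B (λ _ → k) T + k * B ^ T
  go zero = sym (*-identityʳ k)
  go (suc T) = trans (lem k B R) (trans (cong (λ p → k + B * p) (go T)) (lem′ k B R (B ^ T)))
    where
    R = rep B (λ _ → k) T
    lem : ∀ k B R → (k + B * R) * B + k ≡ k + B * (R * B + k)
    lem = solve-∀
    lem′ : ∀ k B R p → k + B * (R + k * p) ≡ k + B * R + k * (B * p)
    lem′ = solve-∀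

liftTm : ∀ {n} {f : Env n → ℕ} → Tm alg f → LiftTm f
liftTm top = record
  { Rel = λ c T X Z → Z ≡ proj₁ X
  ; dio = λ _ _ s z → z ≐ head s
  ; sound = λ { c T r refl → proj₁ r }
  ; complete = λ T xs → 0 , λ _ r → sym (proj₂ (proj₁ r)) }
liftTm (pop t) = record
  { Rel = λ c T X Z → L.Rel c T (proj₂ X) Z
  ; dio = λ c T s z → L.dio c T (tail s) z
  ; sound = λ c T r h → L.sound c T (proj₂ r) h
  ; complete = λ T xs → let c₀ , H = L.complete T (proj₂ ∘ xs) in c₀ , λ le r → H le (proj₂ r) }
  where module L = LiftTm (liftTm t)
liftTm (con k) = record
  { Rel = λ c T X Z → k < 2 ^ c × Z * radix c + k ≡ Z + k * 2 ^ (width c * T)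
  ; dio = λ c T s z → con k ≺ two^ c ∧
      z ⊛ two^ (con 1 ⊕ (c ⊕ c)) ⊕ con k ≐ z ⊕ con k ⊛ two^ ((con 1 ⊕ (c ⊕ c)) ⊛ T)
  ; sound = λ c T _ (k< , e) → (λ _ _ → k<) ,
      affine-unique (radix c) _ _ _ _ (1<2^suc (c + c)) e (constant k c T)
  ; complete = λ T xs → let c₀ , H = bounded 1 (λ _ → k) in
      c₀ , λ {c} le _ → H le 0 (s≤s z≤n) , constant k c T }
liftTm (_⊕_ {f = f} {g} t u) = record
  { Rel = λ c T X Z → Σ ℕ λ Z₁ → Σ ℕ λ Z₂ → L.Rel c T X Z₁ × M.Rel c T X Z₂ × Digits c c T Z × Z ≡ Z₁ + Z₂
  ; dio = λ c T s z → let c = pop (pop c) ; T = pop (pop T) ; s = weaken (weaken s) ; z = pop (pop z) in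
      ex (ex (L.dio c T s (pop top) ∧ M.dio c T s top ∧ digits c c T z ∧ z ≐ pop top ⊕ top))
  ; sound = λ { c T {xs = xs} r (_ , _ , l , m , d , refl) → snd c T xs (L.sound c T r l) (M.sound c T r m) d }
  ; complete = λ T xs → let c₁ , H₁ = L.complete T xs ; c₂ , H₂ = M.complete T xs
                            c₃ , H₃ = bounded T (λ t → f (xs t) + g (xs t)) in
      c₁ ⊔ c₂ ⊔ c₃ , λ {c} le r →
        let le₁₂ = m⊔n≤o⇒m≤o (c₁ ⊔ c₂) c₃ le in
        _ , _ , H₁ (m⊔n≤o⇒m≤o c₁ c₂ le₁₂) r , H₂ (m⊔n≤o⇒n≤o c₁ c₂ le₁₂) r ,
        (_ , H₃ (m⊔n≤o⇒n≤o (c₁ ⊔ c₂) c₃ le) , refl) , rep-+ (radix c) _ _ T }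
  where
  module L = LiftTm (liftTm t)
  module M = LiftTm (liftTm u)
  snd : ∀ c T xs {Z₁ Z₂} → Represents c T Z₁ (f ∘ xs) → Represents c T Z₂ (g ∘ xs) →
    Digits c c T (Z₁ + Z₂) → Represents c T (Z₁ + Z₂) (λ t → f (xs t) + g (xs t))
  snd c T xs (h₁ , refl) (h₂ , refl) d = digits-below c T
    (λ t lt → <-≤-trans (+-mono-< (h₁ t lt) (h₂ t lt)) (2^c+2^c≤B c T)) e d , e
    where e = sym (rep-+ (radix c) (f ∘ xs) (g ∘ xs) T)
liftTm (_⊛_ {f = f} {g} t u) = record
  { Rel = λ c T X Z → Σ ℕ λ Z₁ → Σ ℕ λ Z₂ → L.Rel c T X Z₁ × M.Rel c T X Z₂ × Digits c c T Z × Product c T Z₁ Z₂ Z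
  ; dio = λ c T s z → let c = pop (pop c) ; T = pop (pop T) ; s = weaken (weaken s) ; z = pop (pop z) in
      ex (ex (L.dio c T s (pop top) ∧ M.dio c T s top ∧ digits c c T z ∧ product c T (pop top) top z))
  ; sound = λ { c T {xs = xs} r (_ , _ , l , m , d , p) → snd c T xs (L.sound c T r l) (M.sound c T r m) d p }
  ; complete = λ T xs → let c₁ , H₁ = L.complete T xs ; c₂ , H₂ = M.complete T xs
                            c₃ , H₃ = bounded T (λ t → f (xs t) * g (xs t))
                            c₄ , H₄ = bounded T (f ∘ xs) ; c₅ , H₅ = bounded T (g ∘ xs) in
      c₁ ⊔ (c₂ ⊔ (c₃ ⊔ (c₄ ⊔ c₅))) , λ {c} le r →
        let le₂ = m⊔n≤o⇒n≤o c₁ _ le ; le₃ = m⊔n≤o⇒n≤o c₂ _ le₂ ; le₄ = m⊔n≤o⇒n≤o c₃ _ le₃ in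
        _ , _ , H₁ (m⊔n≤o⇒m≤o c₁ _ le) r , H₂ (m⊔n≤o⇒m≤o c₂ _ le₂) r ,
        (_ , H₃ (m⊔n≤o⇒m≤o c₃ _ le₃) , refl) ,
        product⁺ c T (H₄ (m⊔n≤o⇒m≤o c₄ _ le₄) , refl) (H₅ (m⊔n≤o⇒n≤o c₄ _ le₄) , refl) }
  where
  module L = LiftTm (liftTm t)
  module M = LiftTm (liftTm u)
  snd : ∀ c T xs {Z₁ Z₂ Z} → Represents c T Z₁ (f ∘ xs) → Represents c T Z₂ (g ∘ xs) →
    Digits c c T Z → Product c T Z₁ Z₂ Z → Represents c T Z (λ t → f (xs t) * g (xs t))
  snd c T xs r₁ r₂ d p = digits-below c T
    (λ t lt → ≤-<-trans (*-mono-≤ (<⇒≤ (proj₁ r₁ t lt)) (<⇒≤ (proj₁ r₂ t lt))) (2^c*2^c<B c T)) e d , e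
    where e = product⁻ c T r₁ r₂ p

record LiftDio {n} (P : Env n → Set) : Set₁ where
  field
    Rel      : ℕ → ℕ → Env n → Set
    dio      : ∀ {N} {c T : Env N → ℕ} {X : Env N → Env n} →
               Tm exp c → Tm exp T → Sub X → Dio exp (λ ρ → Rel (c ρ) (T ρ) (X ρ))
    sound    : ∀ c T {X xs} → Represent c T X xs → Rel c T X → ∀ t → t < T → P (xs t)
    complete : ∀ T xs → (∀ t → t < T → P (xs t)) →
               Σ ℕ λ c₀ → ∀ {c X} → c₀ ≤ c → Represent c T X xs → Rel c T X

-- Finite choice: the witnesses at the single digits become the digits of one number.
choose : ∀ {P : ℕ → ℕ → Set} T → (∀ t → t < T → Σ ℕ (P t)) → Σ (ℕ → ℕ) λ v → ∀ t → t < T → P t (v t)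
choose zero h = (λ _ → 0) , λ _ ()
choose {P} (suc T) h with h 0 (s≤s z≤n) | choose {λ t → P (suc t)} T (λ t lt → h (suc t) (s≤s lt))
... | a , p | v , q = (a ◂ v) , λ { zero _ → p ; (suc t) (s≤s lt) → q t lt }

liftDio : ∀ {n} {P : Env n → Set} → Dio alg P → LiftDio P
liftDio (_≐_ {f = f} {g} t u) = record
  { Rel = λ c T X → Σ ℕ λ Z → L.Rel c T X Z × M.Rel c T X Z
  ; dio = λ c T s → ex (L.dio (pop c) (pop T) (weaken s) top ∧ M.dio (pop c) (pop T) (weaken s) top)
  ; sound = λ c T r (_ , l , m) →
      let h₁ , e₁ = L.sound c T r l ; h₂ , e₂ = M.sound c T r m in
      rep-unique (radix c) T (below-radix c T h₁) (below-radix c T h₂) (trans (sym e₁) e₂)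
  ; complete = λ T xs h → let c₁ , H₁ = L.complete T xs ; c₂ , H₂ = M.complete T xs in
      c₁ ⊔ c₂ , λ {c} {X} le r →
        _ , H₁ (m⊔n≤o⇒m≤o c₁ c₂ le) r ,
        subst (M.Rel c T X) (sym (rep-cong (radix c) T h)) (H₂ (m⊔n≤o⇒n≤o c₁ c₂ le) r) }
  where
  module L = LiftTm (liftTm t)
  module M = LiftTm (liftTm u)
liftDio (p ∧ q) = record
  { Rel = λ c T X → L.Rel c T X × M.Rel c T X
  ; dio = λ c T s → L.dio c T s ∧ M.dio c T s
  ; sound = λ c T r (l , m) t lt → L.sound c T r l t lt , M.sound c T r m t lt
  ; complete = λ T xs h →
      let c₁ , H₁ = L.complete T xs (λ t lt → proj₁ (h t lt)) ; c₂ , H₂ = M.complete T xs (λ t lt → proj₂ (h t lt)) in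
      c₁ ⊔ c₂ , λ le r → H₁ (m⊔n≤o⇒m≤o c₁ c₂ le) r , H₂ (m⊔n≤o⇒n≤o c₁ c₂ le) r }
  where
  module L = LiftDio (liftDio p)
  module M = LiftDio (liftDio q)
liftDio (ex {P = P} p) = record
  { Rel = λ c T X → Σ ℕ λ V → Digits c c T V × L.Rel c T (V , X)
  ; dio = λ c T s → ex (digits (pop c) (pop c) (pop T) top ∧ L.dio (pop c) (pop T) (top ∷ weaken s))
  ; sound = λ { c T {xs = xs} r (V , (v , hv , e) , l) t lt → v t , L.sound c T {xs = λ t → v t , xs t} ((hv , e) , r) l t lt }
  ; complete = λ T xs h →
      let v , hv = choose {λ t v → P (v , xs t)} T h
          c₁ , H₁ = bounded T v ; c₂ , H₂ = L.complete T (λ t → v t , xs t) hv in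
      c₁ ⊔ c₂ , λ le r → let b = H₁ (m⊔n≤o⇒m≤o c₁ c₂ le) in
        _ , (v , b , refl) , H₂ (m⊔n≤o⇒n≤o c₁ c₂ le) ((b , refl) , r) }
  where module L = LiftDio (liftDio p)
liftDio (iff to from p) = record
  { Rel = L.Rel
  ; dio = L.dio
  ; sound = λ c T r l t lt → to _ (L.sound c T r l t lt)
  ; complete = λ T xs h → L.complete T xs (λ t lt → from _ (h t lt)) }
  where module L = LiftDio (liftDio p)

-- Runs of a polynomial step relation.

module Runs {Step : Env 2 → Set} (step : Dio alg Step) where
  private
    module L = LiftDio (liftDio step)

  _⟶_ : ℕ → ℕ → Set
  s ⟶ s′ = Step (s , s′ , tt)

  -- The list `S` holds the states that are left, `S′` those that are entered. The digit size `c` is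
  -- quantified as well, since completeness holds only beyond a threshold that depends on the run.
  Run : ℕ → ℕ → Set
  Run a e = Σ ℕ λ c → Σ ℕ λ T → Σ ℕ λ S → Σ ℕ λ S′ →
    a < radix c × Digits c c T S × Digits c c T S′ × L.Rel c T (S , S′ , tt) ×
    S + 2 ^ (width c * T) * e ≡ a + radix c * S′

  -- Since all digits are below B, the equation says that s 0 ≡ a, s (suc t) ≡ s′ t and that the last state is e.
  chain⁻ : ∀ B T s s′ a e → a < B → Below B T s → Below B T s′ → (∀ t → t < T → s t ⟶ s′ t) →
    rep B s T + B ^ T * e ≡ a + B * rep B s′ T → Star _⟶_ a e
  chain⁻ B zero s s′ a e a< hs hs′ st ih
    with refl ← trans (sym (+-identityʳ e)) (trans ih (trans (cong (a +_) (*-zeroʳ B)) (+-identityʳ a))) = ε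
  chain⁻ B (suc T) s s′ a e a< hs hs′ st ih
    with quotient-unique B _ _ (hs 0 (s≤s z≤n)) a< (trans (sym (lem (s 0) B _ (B ^ T) e)) ih)
    where lem : ∀ a B r p e → a + B * r + B * p * e ≡ a + B * (r + p * e)
          lem = solve-∀
  ... | refl , ih′ = st 0 (s≤s z≤n) ◅
    chain⁻ B T (s ∘ suc) (s′ ∘ suc) (s′ 0) e (hs′ 0 (s≤s z≤n)) (below-tail hs) (below-tail hs′) (λ t lt → st (suc t) (s≤s lt)) ih′

  chain⁺ : ∀ {a e} → Star _⟶_ a e → Σ ℕ λ T → Σ (ℕ → ℕ) λ s → Σ (ℕ → ℕ) λ s′ →
    (∀ t → t < T → s t ⟶ s′ t) × (∀ B → rep B s T + B ^ T * e ≡ a + B * rep B s′ T)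
  chain⁺ {a} ε = 0 , (λ _ → 0) , (λ _ → 0) , (λ _ ()) , λ B → lem a B
    where lem : ∀ a B → 0 + 1 * a ≡ a + B * 0
          lem = solve-∀
  chain⁺ {a} {e} (_◅_ {j = b} st sts) with chain⁺ sts
  ... | T , s , s′ , h , ihs = suc T , (a ◂ s) , (b ◂ s′) ,
    (λ { zero _ → st ; (suc t) (s≤s lt) → h t lt }) ,
    λ B → trans (lem a B _ (B ^ T) e) (cong (λ p → a + B * p) (ihs B))
    where lem : ∀ a B r p e → a + B * r + B * p * e ≡ a + B * (r + p * e)
          lem = solve-∀

  run⁻ : ∀ a e → Run a e → Star _⟶_ a e
  run⁻ a e (c , T , _ , _ , a< , (s , hs , refl) , (s′ , hs′ , refl) , l , ih) =
    chain⁻ (radix c) T s s′ a e a< (below-radix c T hs) (below-radix c T hs′)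
      (L.sound c T {xs = λ t → s t , s′ t , tt} ((hs , refl) , (hs′ , refl) , tt) l)
      (trans (cong (λ p → rep (radix c) s T + p * e) (^-*-assoc 2 (width c) T)) ih)

  run⁺ : ∀ a e → Star _⟶_ a e → Run a e
  run⁺ a e sts with chain⁺ sts
  ... | T , s , s′ , h , ihs =
    let c₁ , H₁ = bounded T s ; c₂ , H₂ = bounded T s′ ; c₃ , H₃ = bounded 1 (λ _ → a)
        c₄ , H₄ = L.complete T (λ t → s t , s′ t , tt) h
        c = c₁ ⊔ (c₂ ⊔ (c₃ ⊔ c₄))
        b₁ = H₁ (m≤m⊔n c₁ _)
        b₂ = H₂ (≤-trans (m≤m⊔n c₂ _) (m≤n⊔m c₁ _))
    in c , T , _ , _ ,
       <-trans (H₃ (≤-trans (≤-trans (m≤m⊔n c₃ c₄) (m≤n⊔m c₂ _)) (m≤n⊔m c₁ _)) 0 (s≤s z≤n)) (2^c<B c T) ,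
       (s , b₁ , refl) , (s′ , b₂ , refl) ,
       H₄ (≤-trans (≤-trans (m≤n⊔m c₃ c₄) (m≤n⊔m c₂ _)) (m≤n⊔m c₁ _)) ((b₁ , refl) , (b₂ , refl) , tt) ,
       trans (cong (λ p → rep (radix c) s T + p * e) (sym (^-*-assoc 2 (width c) T))) (ihs (radix c))

  reachable : ∀ {n} {a e : Env n → ℕ} → Tm exp a → Tm exp e → Dio exp (λ ρ → Star _⟶_ (a ρ) (e ρ))
  reachable a e = iff (λ ρ → run⁻ _ _) (λ ρ → run⁺ _ _) (ex (ex (ex (ex (
    w4 a ≺ two^ w ∧ digits c c T S ∧ digits c c T S′ ∧ L.dio c T (S ∷ S′ ∷ []) ∧
    S ⊕ two^ (w ⊛ T) ⊛ w4 e ≐ w4 a ⊕ two^ w ⊛ S′)))))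
    where
    w4 : ∀ {n} {f : Env n → ℕ} → Tm exp f → Tm exp {suc (suc (suc (suc n)))} (λ ρ → f (proj₂ (proj₂ (proj₂ (proj₂ ρ)))))
    w4 t = pop (pop (pop (pop t)))
    S′ = top
    S = pop top
    T = pop (pop top)
    c = pop (pop (pop top))
    w = con 1 ⊕ (c ⊕ c)

-- A polynomial pairing function.

abstract
  -- The summand `a` is too small to reach the square after that of `a + b`, so the sum and then `a`
  -- are determined. No division is involved, which keeps the steps polynomial, and the successor
  -- keeps 0 free for empty stacks and vectors.
  pair : ℕ → ℕ → ℕ
  pair a b = suc ((a + b) * (a + b) + a)

  pair≢0 : ∀ {a b} → pair a b ≢ 0
  pair≢0 ()

  pair-injective : ∀ {a b c d} → pair a b ≡ pair c d → a ≡ c × b ≡ d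
  pair-injective {a} {b} {c} {d} h = case (<-cmp (a + b) (c + d))
    where
    gap : ∀ a b s c → a + b < s → (a + b) * (a + b) + a < s * s + c
    gap a b s c lt = begin-strict
      (a + b) * (a + b) + a              ≤⟨ +-monoʳ-≤ _ (m≤m+n a b) ⟩
      (a + b) * (a + b) + (a + b)        <⟨ s≤s (m≤m+n _ (a + b)) ⟩
      suc ((a + b) * (a + b) + (a + b) + (a + b)) ≡⟨ lem (a + b) ⟩
      suc (a + b) * suc (a + b)          ≤⟨ *-mono-≤ lt lt ⟩
      s * s                              ≤⟨ m≤m+n (s * s) c ⟩
      s * s + c ∎
      where
      open ≤-Reasoning
      lem : ∀ n → suc (n * n + n + n) ≡ suc n * suc n
      lem = solve-∀
    case : Tri (a + b < c + d) (a + b ≡ c + d) (c + d < a + b) → a ≡ c × b ≡ d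
    case (tri< lt _ _) = ⊥-elim (<⇒≢ (gap a b (c + d) c lt) (suc-injective h))
    case (tri> _ _ gt) = ⊥-elim (<⇒≢ (gap c d (a + b) a gt) (sym (suc-injective h)))
    case (tri≈ _ e _) with +-cancelˡ-≡ ((c + d) * (c + d)) a c (subst (λ n → n * n + a ≡ (c + d) * (c + d) + c) e (suc-injective h))
    ... | refl = refl , +-cancelˡ-≡ a b d e

  pairTm : ∀ {k n} {f g : Env n → ℕ} → Tm k f → Tm k g → Tm k (λ ρ → pair (f ρ) (g ρ))
  pairTm t u = con 1 ⊕ ((t ⊕ u) ⊛ (t ⊕ u) ⊕ t)

-- Deterministic rewriting with patterns.

data Pat : Set where
  var   : Fin 5 → Pat
  nat   : ℕ → Pat
  1+     : Pat → Pat
  ⟨_,_⟩ : Pat → Pat → Pat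

Val : Set
Val = Fin 5 → ℕ

eval : Pat → Val → ℕ
eval (var i) ν = ν i
eval (nat k) ν = k
eval (1+ p) ν = suc (eval p ν)
eval ⟨ p , q ⟩ ν = pair (eval p ν) (eval q ν)

evalTm : ∀ {k n} {ν : Env n → Val} → (∀ i → Tm k (λ ρ → ν ρ i)) → ∀ p → Tm k (λ ρ → eval p (ν ρ))
evalTm ts (var i) = ts i
evalTm ts (nat k) = con k
evalTm ts (1+ p) = con 1 ⊕ evalTm ts p
evalTm ts ⟨ p , q ⟩ = pairTm (evalTm ts p) (evalTm ts q)

-- A sufficient test for having no common instance, Boolean so that determinism of the concrete
-- rules is checked by computation. Among the literals only 0 clashes with a pair: a positive one
-- may be its code.
clash : Pat → Pat → Bool
clash (nat i) (nat j) = not (i ≡ᵇ j)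
clash (nat zero) (1+ _) = true
clash (nat zero) ⟨ _ , _ ⟩ = true
clash (1+ _) (nat zero) = true
clash ⟨ _ , _ ⟩ (nat zero) = true
clash (1+ p) (1+ q) = clash p q
clash ⟨ p , q ⟩ ⟨ p′ , q′ ⟩ = clash p p′ ∨ clash q q′
clash _ _ = false

∨-true : ∀ {a b} → a ∨ b ≡ true → a ≡ true ⊎ b ≡ true
∨-true {true} h = inj₁ refl
∨-true {false} h = inj₂ h

&-true : ∀ {a b} → a & b ≡ true → a ≡ true × b ≡ true
&-true {true} h = refl , h

≡ᵇ-refl : ∀ i → (i ≡ᵇ i) ≡ true
≡ᵇ-refl zero = refl
≡ᵇ-refl (suc i) = ≡ᵇ-refl i

clash-sound : ∀ p q {ν ν′} → clash p q ≡ true → eval p ν ≢ eval q ν′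
clash-sound (nat i) (nat .i) h refl with () ← trans (sym h) (cong not (≡ᵇ-refl i))
clash-sound (nat zero) (1+ q) h ()
clash-sound (nat zero) ⟨ q , q₁ ⟩ h e = pair≢0 (sym e)
clash-sound (1+ p) (nat zero) h ()
clash-sound ⟨ p , p₁ ⟩ (nat zero) h e = pair≢0 e
clash-sound (1+ p) (1+ q) h e = clash-sound p q h (suc-injective e)
clash-sound ⟨ p , q ⟩ ⟨ p′ , q′ ⟩ h e with ∨-true h | pair-injective e
... | inj₁ h | e , _ = clash-sound p p′ h e
... | inj₂ h | _ , e = clash-sound q q′ h e
clash-sound (nat (suc i)) (1+ q) () e
clash-sound (nat (suc i)) ⟨ q , q₁ ⟩ () e
clash-sound (1+ p) (nat (suc i)) () e
clash-sound ⟨ p , p₁ ⟩ (nat (suc i)) () e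
clash-sound (var i) q () e
clash-sound (nat i) (var j) h e with i
clash-sound (nat i) (var j) () e | zero
clash-sound (nat i) (var j) () e | suc _
clash-sound (1+ p) (var j) () e
clash-sound (1+ p) ⟨ q , q₁ ⟩ () e
clash-sound ⟨ p , p₁ ⟩ (var j) () e
clash-sound ⟨ p , p₁ ⟩ (1+ q) () e

occurs : Fin 5 → Pat → Bool
occurs i (var j) = Fin.toℕ i ≡ᵇ Fin.toℕ j
occurs i (nat k) = false
occurs i (1+ p) = occurs i p
occurs i ⟨ p , q ⟩ = occurs i p ∨ occurs i q

-- For the two sides of a rule: no variable appears only on the right, so the left instance fixes
-- the right one.
covers : Pat → Pat → Bool
covers p (var i) = occurs i p
covers p (nat k) = true
covers p (1+ q) = covers p q
covers p ⟨ q , q′ ⟩ = covers p q & covers p q′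

toℕ-≡ᵇ : ∀ {n} (i j : Fin n) → (Fin.toℕ i ≡ᵇ Fin.toℕ j) ≡ true → i ≡ j
toℕ-≡ᵇ fzero fzero h = refl
toℕ-≡ᵇ (fsuc i) (fsuc j) h = cong fsuc (toℕ-≡ᵇ i j h)

occurs-determined : ∀ p {i ν ν′} → occurs i p ≡ true → eval p ν ≡ eval p ν′ → ν i ≡ ν′ i
occurs-determined (var j) {i} h e with refl ← toℕ-≡ᵇ i j h = e
occurs-determined (1+ p) h e = occurs-determined p h (suc-injective e)
occurs-determined ⟨ p , q ⟩ h e with ∨-true h | pair-injective e
... | inj₁ h | e , _ = occurs-determined p h e
... | inj₂ h | _ , e = occurs-determined q h e

covers-determined : ∀ p q {ν ν′} → covers p q ≡ true → eval p ν ≡ eval p ν′ → eval q ν ≡ eval q ν′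
covers-determined p (var i) h e = occurs-determined p h e
covers-determined p (nat k) h e = refl
covers-determined p (1+ q) h e = cong suc (covers-determined p q h e)
covers-determined p ⟨ q , q′ ⟩ h e with &-true h
... | h₁ , h₂ = cong₂ pair (covers-determined p q h₁ e) (covers-determined p q′ h₂ e)

infix 1 _⇒_

record Rule : Set where
  constructor _⇒_
  field
    lhs rhs : Pat

open Rule

Fires : List Rule → Val → ℕ → ℕ → Set
Fires [] ν s s′ = ⊥
Fires (r ∷ rs) ν s s′ = (s ≡ eval (lhs r) ν × s′ ≡ eval (rhs r) ν) ⊎ Fires rs ν s s′

fire : ∀ rs (i : Fin (List.length rs)) ν → Fires rs ν (eval (lhs (List.lookup rs i)) ν) (eval (rhs (List.lookup rs i)) ν)
fire (r ∷ rs) fzero ν = inj₁ (refl , refl)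
fire (r ∷ rs) (fsuc i) ν = inj₂ (fire rs i ν)

clashes : Pat → List Rule → Bool
clashes p [] = true
clashes p (r ∷ rs) = clash (lhs r) p & clashes p rs

separated : List Rule → Bool
separated [] = true
separated (r ∷ rs) = covers (lhs r) (rhs r) & (clashes (lhs r) rs & separated rs)

clashes-sound : ∀ rs p ν ν′ {s} → clashes p rs ≡ true → ¬ Fires rs ν (eval p ν′) s
clashes-sound (r ∷ rs) p ν ν′ h (inj₁ (e , _)) = clash-sound (lhs r) p (proj₁ (&-true h)) (sym e)
clashes-sound (r ∷ rs) p ν ν′ h (inj₂ f) = clashes-sound rs p ν ν′ (proj₂ (&-true {clash (lhs r) p} h)) f

fires-deterministic : ∀ rs → separated rs ≡ true → ∀ ν ν′ {s s₁ s₂} → Fires rs ν s s₁ → Fires rs ν′ s s₂ → s₁ ≡ s₂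
fires-deterministic (r ∷ rs) h ν ν′ f f′ with &-true {covers (lhs r) (rhs r)} h
... | hc , h′ with &-true {clashes (lhs r) rs} h′
fires-deterministic (r ∷ rs) h ν ν′ (inj₁ (refl , refl)) (inj₁ (e , refl)) | hc , h′ | hs , h″ =
  covers-determined (lhs r) (rhs r) hc e
fires-deterministic (r ∷ rs) h ν ν′ (inj₁ (refl , _)) (inj₂ f) | hc , h′ | hs , h″ = ⊥-elim (clashes-sound rs (lhs r) _ _ hs f)
fires-deterministic (r ∷ rs) h ν ν′ (inj₂ f) (inj₁ (refl , _)) | hc , h′ | hs , h″ = ⊥-elim (clashes-sound rs (lhs r) _ _ hs f)
fires-deterministic (r ∷ rs) h ν ν′ (inj₂ f) (inj₂ f′) | hc , h′ | hs , h″ = fires-deterministic rs h″ ν ν′ f f′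

-- Multiplying both sides of every equation by `e` switches it off where `e` is 0. There an
-- existential takes the dummy witness 0.
guard : ∀ {n} {e : Env n → ℕ} {P : Env n → Set} → Tm alg e → Dio alg P → Dio alg (λ ρ → e ρ ≡ 0 ⊎ P ρ)
guard {e = e} t (_≐_ {f = f} {g} u v) = iff
  (λ ρ → to (e ρ) (f ρ) (g ρ)) (λ ρ → from (e ρ) (f ρ) (g ρ)) (t ⊛ u ≐ t ⊛ v)
  where
  to : ∀ e a b → e * a ≡ e * b → e ≡ 0 ⊎ a ≡ b
  to zero a b h = inj₁ refl
  to (suc e) a b h = inj₂ (*-cancelˡ-≡ a b (suc e) h)
  from : ∀ e a b → e ≡ 0 ⊎ a ≡ b → e * a ≡ e * b
  from e a b (inj₁ refl) = refl
  from e a b (inj₂ refl) = refl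
guard t (p ∧ q) = iff
  (λ { ρ (inj₁ h , _) → inj₁ h ; ρ (inj₂ _ , inj₁ h) → inj₁ h ; ρ (inj₂ a , inj₂ b) → inj₂ (a , b) })
  (λ { ρ (inj₁ h) → inj₁ h , inj₁ h ; ρ (inj₂ (a , b)) → inj₂ a , inj₂ b })
  (guard t p ∧ guard t q)
guard t (ex p) = iff
  (λ { ρ (v , inj₁ h) → inj₁ h ; ρ (v , inj₂ h) → inj₂ (v , h) })
  (λ { ρ (inj₁ h) → 0 , inj₁ h ; ρ (inj₂ (v , h)) → v , inj₂ h })
  (ex (guard (pop t) p))
guard t (iff to from p) = iff
  (λ { ρ (inj₁ h) → inj₁ h ; ρ (inj₂ h) → inj₂ (to ρ h) })
  (λ { ρ (inj₁ h) → inj₁ h ; ρ (inj₂ h) → inj₂ (from ρ h) })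
  (guard t p)

fires : ∀ rs {n} {ν : Env n → Val} {s s′ : Env n → ℕ} → (∀ i → Tm alg (λ ρ → ν ρ i)) →
  Tm alg s → Tm alg s′ → Dio alg (λ ρ → Fires rs (ν ρ) (s ρ) (s′ ρ))
fires [] ts s s′ = iff (λ { _ () }) (λ { _ () }) (con 0 ≐ con 1)
fires (r ∷ rs) ts s s′ = iff
  (λ { ρ (zero , suc _ , _ , _ , inj₁ ()) ; ρ (zero , suc _ , _ , _ , inj₂ f) → inj₂ f
     ; ρ (suc _ , _ , _ , inj₂ f , _) → inj₁ f ; ρ (suc _ , _ , _ , inj₁ () , _)
     ; ρ (zero , zero , () , _) })
  (λ { ρ (inj₁ f) → 1 , 0 , refl , inj₂ f , inj₁ refl ; ρ (inj₂ f) → 0 , 1 , refl , inj₁ refl , inj₂ f })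
  -- Disjunction by two switches with sum 1: one of them is 1, and the part that it guards must
  -- hold.
  (ex (ex (pop top ⊕ top ≐ con 1 ∧
    guard (pop top) (pop (pop s) ≐ evalTm ts′ (lhs r) ∧ pop (pop s′) ≐ evalTm ts′ (rhs r)) ∧
    guard top (fires rs ts′ (pop (pop s)) (pop (pop s′))))))
  where
  ts′ = λ i → pop (pop (ts i))

-- A machine for partial recursive functions: a state is a stack of instructions together with a value.
-- An instruction is a pair of a tag and its operands, a vector is a right nested pair ending in 0.

rules : List Rule
rules =
  (⟨ ⟨ ⟨ nat 0 , nat 0 ⟩ , K ⟩ , v ⟩ ⇒ ⟨ K , nat 0 ⟩) ∷
  (⟨ ⟨ ⟨ nat 1 , nat 0 ⟩ , K ⟩ , ⟨ n , v ⟩ ⟩ ⇒ ⟨ K , 1+ n ⟩) ∷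
  (⟨ ⟨ ⟨ nat 2 , nat 0 ⟩ , K ⟩ , ⟨ n , v ⟩ ⟩ ⇒ ⟨ K , n ⟩) ∷
  (⟨ ⟨ ⟨ nat 3 , f ⟩ , K ⟩ , ⟨ n , v ⟩ ⟩ ⇒ ⟨ ⟨ f , K ⟩ , v ⟩) ∷
  (⟨ ⟨ ⟨ nat 4 , ⟨ f , g ⟩ ⟩ , K ⟩ , v ⟩ ⇒ ⟨ ⟨ g , ⟨ f , K ⟩ ⟩ , v ⟩) ∷
  -- Tags 5 to 7 evaluate a vector of programs: 5 keeps the input for the remaining ones, 6 stores
  -- the first result, 7 puts it in front of the others.
  (⟨ ⟨ ⟨ nat 5 , ⟨ f , g ⟩ ⟩ , K ⟩ , v ⟩ ⇒ ⟨ ⟨ f , ⟨ ⟨ nat 6 , ⟨ g , v ⟩ ⟩ , K ⟩ ⟩ , v ⟩) ∷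
  (⟨ ⟨ ⟨ nat 6 , ⟨ g , v ⟩ ⟩ , K ⟩ , n ⟩ ⇒ ⟨ ⟨ g , ⟨ ⟨ nat 7 , n ⟩ , K ⟩ ⟩ , v ⟩) ∷
  (⟨ ⟨ ⟨ nat 7 , n ⟩ , K ⟩ , v ⟩ ⇒ ⟨ K , ⟨ n , v ⟩ ⟩) ∷
  -- Tags 8 and 9 are primitive recursion: 9 waits for the value at `n` and receives it in the
  -- variable `f`.
  (⟨ ⟨ ⟨ nat 8 , ⟨ f , g ⟩ ⟩ , K ⟩ , ⟨ nat 0 , v ⟩ ⟩ ⇒ ⟨ ⟨ f , K ⟩ , v ⟩) ∷
  (⟨ ⟨ ⟨ nat 8 , ⟨ f , g ⟩ ⟩ , K ⟩ , ⟨ 1+ n , v ⟩ ⟩ ⇒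
    ⟨ ⟨ ⟨ nat 8 , ⟨ f , g ⟩ ⟩ , ⟨ ⟨ nat 9 , ⟨ g , ⟨ n , v ⟩ ⟩ ⟩ , K ⟩ ⟩ , ⟨ n , v ⟩ ⟩) ∷
  (⟨ ⟨ ⟨ nat 9 , ⟨ g , ⟨ n , v ⟩ ⟩ ⟩ , K ⟩ , f ⟩ ⇒ ⟨ ⟨ g , K ⟩ , ⟨ n , ⟨ f , v ⟩ ⟩ ⟩) ∷
  -- Tags 10 and 11 are minimisation: 11 carries the candidate `n` under test, returns it on the
  -- value 0 and passes to `1+ n` otherwise.
  (⟨ ⟨ ⟨ nat 10 , f ⟩ , K ⟩ , v ⟩ ⇒ ⟨ ⟨ f , ⟨ ⟨ nat 11 , ⟨ f , ⟨ nat 0 , v ⟩ ⟩ ⟩ , K ⟩ ⟩ , ⟨ nat 0 , v ⟩ ⟩) ∷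
  (⟨ ⟨ ⟨ nat 11 , ⟨ f , ⟨ n , v ⟩ ⟩ ⟩ , K ⟩ , nat 0 ⟩ ⇒ ⟨ K , n ⟩) ∷
  (⟨ ⟨ ⟨ nat 11 , ⟨ f , ⟨ n , v ⟩ ⟩ ⟩ , K ⟩ , 1+ g ⟩ ⇒
    ⟨ ⟨ f , ⟨ ⟨ nat 11 , ⟨ f , ⟨ 1+ n , v ⟩ ⟩ ⟩ , K ⟩ ⟩ , ⟨ 1+ n , v ⟩ ⟩) ∷
  []
  where
  K = var (Fin.# 0)
  f = var (Fin.# 1)
  g = var (Fin.# 2)
  n = var (Fin.# 3)
  v = var (Fin.# 4)

vals : ℕ → ℕ → ℕ → ℕ → ℕ → Val
vals K f g n v fzero = K
vals K f g n v (fsuc fzero) = f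
vals K f g n v (fsuc (fsuc fzero)) = g
vals K f g n v (fsuc (fsuc (fsuc fzero))) = n
vals K f g n v (fsuc (fsuc (fsuc (fsuc fzero)))) = v

Step : Env 2 → Set
Step ρ = Σ ℕ λ v → Σ ℕ λ n → Σ ℕ λ g → Σ ℕ λ f → Σ ℕ λ K →
  Fires rules (vals K f g n v) (proj₁ ρ) (proj₁ (proj₂ ρ))

valsTm : ∀ i → Tm alg {7} (λ (K , f , g , n , v , _) → vals K f g n v i)
valsTm fzero = top
valsTm (fsuc fzero) = pop top
valsTm (fsuc (fsuc fzero)) = pop (pop top)
valsTm (fsuc (fsuc (fsuc fzero))) = pop (pop (pop top))
valsTm (fsuc (fsuc (fsuc (fsuc fzero)))) = pop (pop (pop (pop top)))

step : Dio alg Step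
step = ex (ex (ex (ex (ex (fires rules valsTm (pop (pop (pop (pop (pop top))))) (pop (pop (pop (pop (pop (pop top)))))))))))

open Runs step public

step-deterministic : ∀ {s s₁ s₂} → s ⟶ s₁ → s ⟶ s₂ → s₁ ≡ s₂
step-deterministic (v , n , g , f , K , h) (v′ , n′ , g′ , f′ , K′ , h′) =
  fires-deterministic rules refl (vals K f g n v) (vals K′ f′ g′ n′ v′) h h′

Stuck : ℕ → Set
Stuck s = ∀ {s′} → ¬ (s ⟶ s′)

-- The empty stack is 0, whereas every left side has a pair in that place.
stuck-pair : ∀ r → Stuck (pair 0 r)
stuck-pair r (v , n , g , f , K , h) =
  clashes-sound rules ⟨ nat 0 , var fzero ⟩ (vals K f g n v) (λ _ → r) refl h

normal-unique : ∀ {s a b} → Star _⟶_ s a → Star _⟶_ s b → Stuck a → Stuck b → a ≡ b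
normal-unique ε ε _ _ = refl
normal-unique ε (st ◅ _) ha _ = ⊥-elim (ha st)
normal-unique (st ◅ _) ε _ hb = ⊥-elim (hb st)
normal-unique (st ◅ sts) (st′ ◅ sts′) ha hb with refl ← step-deterministic st st′ = normal-unique sts sts′ ha hb

-- Codes of programs and their simulation.

⌜_⌝ : ∀ {n} → PR n → ℕ
⌜_⌝* : ∀ {n m} → Vec (PR n) m → ℕ
⌜_⌝ᵖ : ∀ {n} → Fin n → ℕ
⌜ Zf ⌝ = pair 0 0
⌜ Sf ⌝ = pair 1 0
⌜ Pf i ⌝ = ⌜ i ⌝ᵖ
⌜ Cf f gs ⌝ = pair 4 (pair ⌜ f ⌝ ⌜ gs ⌝*)
⌜ Rf f g ⌝ = pair 8 (pair ⌜ f ⌝ ⌜ g ⌝)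
⌜ Mf f ⌝ = pair 10 ⌜ f ⌝
-- The empty vector of results is coded by 0, so the zero program produces it.
⌜ [] ⌝* = pair 0 0
⌜ g ∷ gs ⌝* = pair 5 (pair ⌜ g ⌝ ⌜ gs ⌝*)
⌜ fzero ⌝ᵖ = pair 2 0
⌜ fsuc i ⌝ᵖ = pair 3 ⌜ i ⌝ᵖ

vec : ∀ {n} → Vec ℕ n → ℕ
vec [] = 0
vec (a ∷ as) = pair a (vec as)

by : ∀ (i : Fin 14) (K f g n v : ℕ) →
  eval (lhs (List.lookup rules i)) (vals K f g n v) ⟶ eval (rhs (List.lookup rules i)) (vals K f g n v)
by i K f g n v = v , n , g , f , K , fire rules i (vals K f g n v)

run-eval : ∀ {n} {f : PR n} {as r} → Eval f as r → ∀ K → Star _⟶_ (pair (pair ⌜ f ⌝ K) (vec as)) (pair K r)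
run-all : ∀ {n m} {gs : Vec (PR n) m} {as rs} → EvalAll gs as rs → ∀ K →
  Star _⟶_ (pair (pair ⌜ gs ⌝* K) (vec as)) (pair K (vec rs))
run-proj : ∀ {n} (i : Fin n) as K → Star _⟶_ (pair (pair ⌜ i ⌝ᵖ K) (vec as)) (pair K (lookup as i))
-- The recursion is on `d`, the number of candidates still to be refuted; the first state has just
-- started the test of `b`.
run-search : ∀ {n} {f : PR (suc n)} {as} d b {a} → d + b ≡ a → Eval f (a ∷ as) 0 →
  (∀ b → b < a → Σ ℕ λ r → Eval f (b ∷ as) (suc r)) → ∀ K →
  Star _⟶_ (pair (pair ⌜ f ⌝ (pair (pair 11 (pair ⌜ f ⌝ (pair b (vec as)))) K)) (pair b (vec as))) (pair K a)

run-proj fzero (a ∷ as) K = by (Fin.# 2) K 0 0 a (vec as) ◅ ε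
run-proj (fsuc i) (a ∷ as) K = by (Fin.# 3) K ⌜ i ⌝ᵖ 0 a (vec as) ◅ run-proj i as K

run-eval {as = as} eZ K = by (Fin.# 0) K 0 0 0 (vec as) ◅ ε
run-eval (eS {a}) K = by (Fin.# 1) K 0 0 a 0 ◅ ε
run-eval (eP {i = i} {as}) K = run-proj i as K
run-eval {as = as} (eC {f = f} {gs} ds d) K =
  by (Fin.# 4) K ⌜ f ⌝ ⌜ gs ⌝* 0 (vec as) ◅ run-all ds (pair ⌜ f ⌝ K) ◅◅ run-eval d K
run-eval (eR0 {f = f} {g} {as} d) K = by (Fin.# 8) K ⌜ f ⌝ ⌜ g ⌝ 0 (vec as) ◅ run-eval d K
run-eval (eRS {f = f} {g} {a} {as} {r} d d′) K =
  by (Fin.# 9) K ⌜ f ⌝ ⌜ g ⌝ a (vec as) ◅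
  run-eval d (pair (pair 9 (pair ⌜ g ⌝ (pair a (vec as)))) K) ◅◅
  (by (Fin.# 10) K r ⌜ g ⌝ a (vec as) ◅ run-eval d′ K)
run-eval {as = as} (eM {f = f} {a = a} d h) K =
  by (Fin.# 11) K ⌜ f ⌝ 0 0 (vec as) ◅ run-search a 0 (+-identityʳ a) d h K

run-all {as = as} [] K = by (Fin.# 0) K 0 0 0 (vec as) ◅ ε
run-all {as = as} (_∷_ {g = g} {gs} {r = r} {rs} d ds) K =
  by (Fin.# 5) K ⌜ g ⌝ ⌜ gs ⌝* 0 (vec as) ◅
  run-eval d (pair (pair 6 (pair ⌜ gs ⌝* (vec as))) K) ◅◅
  (by (Fin.# 6) K 0 ⌜ gs ⌝* r (vec as) ◅
  run-all ds (pair (pair 7 r) K) ◅◅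
  (by (Fin.# 7) K 0 0 r (vec rs) ◅ ε))

run-search {f = f} {as} zero b refl d h K =
  run-eval d (pair (pair 11 (pair ⌜ f ⌝ (pair b (vec as)))) K) ◅◅ (by (Fin.# 12) K ⌜ f ⌝ 0 b (vec as) ◅ ε)
run-search {f = f} {as} (suc c) b e d h K =
  run-eval (proj₂ (h b (subst (suc b ≤_) e (s≤s (m≤n+m b c))))) (pair (pair 11 (pair ⌜ f ⌝ (pair b (vec as)))) K) ◅◅
  (by (Fin.# 13) K ⌜ f ⌝ (proj₁ (h b (subst (suc b ≤_) e (s≤s (m≤n+m b c))))) b (vec as) ◅
  run-search c (suc b) (trans (+-suc c b) e) d h K)

-- Matrix products as runs of weighted automata.

open import Data.Integer using (+_)

-- Entries are constants or the parameter itself, so all instances share one dimension, and the code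
-- of the morphism is primitive recursive in the parameter.
data Ent : Set where
  con : ℤ → Ent
  par : Ent

ent : ℕ → Ent → ℤ
ent p (con c) = c
ent p par = + p

zeros : ∀ {k} → Vec Ent k
zeros = Vec.replicate _ (con (+ 0))

edge : ∀ {k} → Fin k → Ent → Vec Ent k
edge fzero c = c ∷ zeros
edge (fsuc i) c = con (+ 0) ∷ edge i c

dot : ∀ {k} → ℕ → Vec Ent k → Vec ℤ k → ℤ
dot p [] [] = + 0
dot p (c ∷ r) (a ∷ v) = ent p c ℤ.* a ℤ.+ dot p r v

dot-zeros : ∀ {k} p (v : Vec ℤ k) → dot p zeros v ≡ + 0
dot-zeros p [] = refl
dot-zeros p (a ∷ v) = trans (cong₂ ℤ._+_ (ℤ.*-zeroˡ a) (dot-zeros p v)) refl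

dot-edge : ∀ {k} p (i : Fin k) c v → dot p (edge i c) v ≡ ent p c ℤ.* lookup v i
dot-edge p fzero c (a ∷ v) = trans (cong (ℤ._+_ (ent p c ℤ.* a)) (dot-zeros p v)) (ℤ.+-identityʳ _)
dot-edge p (fsuc i) c (a ∷ v) = trans (cong₂ ℤ._+_ (ℤ.*-zeroˡ a) (dot-edge p i c v)) (ℤ.+-identityˡ _)

-- A family of upper triangular matrices indexed by the letters, given by its rows from the diagonal on.
infixr 5 _∷ᵃ_

data Aut : ℕ → Set where
  []   : Aut 0
  _∷ᵃ_ : ∀ {k} → (Δ → Vec Ent (suc k)) → Aut k → Aut (suc k)

entryᵃ : ∀ {k} → Aut k → Δ → Fin k → Fin k → Ent
entryᵃ (r ∷ᵃ A) a fzero j = lookup (r a) j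
entryᵃ (r ∷ᵃ A) a (fsuc i) fzero = con (+ 0)
entryᵃ (r ∷ᵃ A) a (fsuc i) (fsuc j) = entryᵃ A a i j

entryᵃ-upper : ∀ {k} (A : Aut k) a p i j → toℕ j < toℕ i → ent p (entryᵃ A a i j) ≡ + 0
entryᵃ-upper (r ∷ᵃ A) a p (fsuc i) fzero lt = refl
entryᵃ-upper (r ∷ᵃ A) a p (fsuc i) (fsuc j) (s≤s lt) = entryᵃ-upper A a p i j lt

matrix : ∀ {k} → Aut k → ℕ → Δ → Mat k
matrix A p a = tabulate λ i → tabulate λ j → ent p (entryᵃ A a i j)

entry-tabulate : ∀ {k} (f : Fin k → Fin k → ℤ) i j → entry (tabulate λ i → tabulate (f i)) i j ≡ f i j
entry-tabulate f i j = trans (cong (λ r → lookup r j) (lookup∘tabulate (λ i → tabulate (f i)) i)) (lookup∘tabulate (f i) j)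

entry-matrix : ∀ {k} (A : Aut k) p a i j → entry (matrix A p a) i j ≡ ent p (entryᵃ A a i j)
entry-matrix A p a = entry-tabulate (λ i j → ent p (entryᵃ A a i j))

morphism : ∀ {k} → Aut k → ℕ → Morphism k
morphism A p a = matrix A p a ,
  λ i j lt → trans (entry-matrix A p a i j) (entryᵃ-upper A a p i j lt)

act : ∀ {k} → Aut k → ℕ → Δ → Vec ℤ k → Vec ℤ k
act [] p a [] = []
act (r ∷ᵃ A) p a (b ∷ v) = dot p (r a) (b ∷ v) ∷ act A p a v

-- Words act on column vectors, the last letter first. The columns of the matrix of a word are the
-- runs from the unit vectors.
run : ∀ {k} → Aut k → ℕ → List Δ → Vec ℤ k → Vec ℤ k
run A p [] u = u
run A p (a ∷ w) u = act A p a (run A p w u)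

dot-sum : ∀ {k} p (r : Vec Ent k) v → dot p r v ≡ sumℤ (tabulate λ l → ent p (lookup r l) ℤ.* lookup v l)
dot-sum p [] [] = refl
dot-sum p (c ∷ r) (a ∷ v) = cong (ℤ._+_ (ent p c ℤ.* a)) (dot-sum p r v)

act-sum : ∀ {k} (A : Aut k) p a v i →
  lookup (act A p a v) i ≡ sumℤ (tabulate λ l → ent p (entryᵃ A a i l) ℤ.* lookup v l)
act-sum (r ∷ᵃ A) p a (b ∷ v) fzero = dot-sum p (r a) (b ∷ v)
act-sum (r ∷ᵃ A) p a (b ∷ v) (fsuc i) = trans (act-sum A p a v i)
  (sym (trans (cong (ℤ._+ rest) (ℤ.*-zeroˡ b)) (ℤ.+-identityˡ rest)))
  where rest = sumℤ (tabulate λ l → ent p (entryᵃ A a i l) ℤ.* lookup v l)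

unit : ∀ {k} → Fin k → Vec ℤ k
unit fzero = + 1 ∷ Vec.replicate _ (+ 0)
unit (fsuc i) = + 0 ∷ unit i

lookup-unit : ∀ {k} (i : Fin k) → lookup (unit i) i ≡ + 1
lookup-unit fzero = refl
lookup-unit (fsuc i) = lookup-unit i

lookup-unit-≢ : ∀ {k} (i j : Fin k) → i ≢ j → lookup (unit j) i ≡ + 0
lookup-unit-≢ fzero fzero ne = ⊥-elim (ne refl)
lookup-unit-≢ fzero (fsuc j) ne = refl
lookup-unit-≢ (fsuc i) fzero ne = lookup-replicate i (+ 0)
lookup-unit-≢ (fsuc i) (fsuc j) ne = lookup-unit-≢ i j (ne ∘ cong fsuc)

entry-idMat : ∀ {k} (i j : Fin k) → entry (idMat k) i j ≡ lookup (unit j) i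
entry-idMat {k} i j = trans (proj₂ value) go
  where
  -- The witness is left to unification, so that `go` can split on the comparison inside `idMat`.
  value : Σ ℤ λ a → entry (idMat k) i j ≡ a
  value = _ , entry-tabulate _ i j
  go : proj₁ value ≡ lookup (unit j) i
  go with i Fin.≟ j
  ... | yes refl = sym (lookup-unit i)
  ... | no ne = sym (lookup-unit-≢ i j ne)

entry-apply : ∀ {k} (A : Aut k) p w i j → entry (apply (morphism A p) w) i j ≡ lookup (run A p w (unit j)) i
entry-apply {k} A p [] i j = entry-idMat i j
entry-apply A p (a ∷ w) i j = trans (entry-tabulate _ i j)
  (trans (cong sumℤ (tabulate-cong λ l → cong₂ ℤ._*_ (entry-matrix A p a i l) (entry-apply A p w l j)))
    (sym (act-sum A p a (run A p w (unit j)) i)))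

-- Automata for monomials in the exponents.

data Fac : Set where
  one idn two : Fac

val : Fac → ℕ → ℤ
val one n = + 1
val idn n = + n
val two n = + (2 ^ n)

data End : Set where
  inner last : End

letterᵉ : End → Δ
letterᵉ inner = y
letterᵉ last = z₂

-- A state works on each `x`, hands over at its own closing letter and is annihilated by every other
-- letter.
row : ∀ {k} → End → Vec Ent k → Vec Ent k → Δ → Vec Ent k
row e X C x = X
row e X C z₁ = zeros
row inner X C y = C
row inner X C z₂ = zeros
row last X C y = zeros
row last X C z₂ = C

row-letter : ∀ {k} e (X C : Vec Ent k) → row e X C (letterᵉ e) ≡ C
row-letter inner X C = refl
row-letter last X C = refl

-- Reading `x`, the first state becomes `self` times itself plus `link` times the second, which
-- gives the recurrences of `1`, `n` and `2 ^ n`. For `idn` this is the unipotent Jordan block of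
-- size 2, whose powers have `n` in the corner.
self link out₀ out₁ : Fac → ℤ
self one = + 1
self idn = + 1
self two = + 2
link one = + 0
link idn = + 1
link two = + 0
out₀ one = + 1
out₀ idn = + 0
out₀ two = + 1
out₁ one = + 0
out₁ idn = + 1
out₁ two = + 0

row₀ : ∀ {k} → End → Fac → Fin k → Δ → Vec Ent (suc (suc k))
row₀ e φ τ = row e (con (self φ) ∷ con (link φ) ∷ zeros) (con (+ 0) ∷ con (+ 0) ∷ edge τ (con (out₀ φ)))

row₁ : ∀ {k} → End → Fac → Fin k → Δ → Vec Ent (suc k)
row₁ e φ τ = row e (con (+ 1) ∷ zeros) (con (+ 0) ∷ edge τ (con (out₁ φ)))

-- Reading x ^ n and the closing letter from the first of the two new states
-- multiplies the value of the state τ by val φ n.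
block : ∀ {k} → End → Fac → Aut k → Fin k → Aut (suc (suc k))
block e φ A τ = row₀ e φ τ ∷ᵃ row₁ e φ τ ∷ᵃ A

-- By triangularity the lower coordinates never see the first one, so states added on top leave
-- everything below unchanged.
run-∷ : ∀ {k} r (A : Aut k) p w u →
  run (r ∷ᵃ A) p w u ≡ lookup (run (r ∷ᵃ A) p w u) fzero ∷ run A p w (Vec.tail u)
run-∷ r A p [] (a ∷ u) = refl
run-∷ r A p (l ∷ w) u = trans (cong (act (r ∷ᵃ A) p l) ih)
  (cong (λ v → lookup (act (r ∷ᵃ A) p l v) fzero ∷ act A p l (run A p w (Vec.tail u))) (sym ih))
  where ih = run-∷ r A p w u

run-∷∷ : ∀ {k} r r′ (A : Aut k) p w u → Σ ℤ λ a → Σ ℤ λ b →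
  run (r ∷ᵃ r′ ∷ᵃ A) p w u ≡ a ∷ b ∷ run A p w (Vec.tail (Vec.tail u))
run-∷∷ r r′ A p w u = _ , _ , trans (run-∷ r (r′ ∷ᵃ A) p w u)
  (cong (lookup (run (r ∷ᵃ r′ ∷ᵃ A) p w u) fzero ∷_) (run-∷ r′ A p w (Vec.tail u)))

dot-00 : ∀ {k} p (r : Vec Ent k) a b v → dot p (con (+ 0) ∷ con (+ 0) ∷ r) (a ∷ b ∷ v) ≡ dot p r v
dot-00 p r a b v = lem a b (dot p r v)
  where lem : ∀ a b c → + 0 ℤ.* a ℤ.+ (+ 0 ℤ.* b ℤ.+ c) ≡ c
        lem = solveℤ-∀

val-suc : ∀ φ n g → self φ ℤ.* (val φ n ℤ.* g) ℤ.+ (link φ ℤ.* (out₁ φ ℤ.* g) ℤ.+ + 0) ≡ val φ (suc n) ℤ.* g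
val-suc one n g = lem g
  where lem : ∀ g → + 1 ℤ.* (+ 1 ℤ.* g) ℤ.+ (+ 0 ℤ.* (+ 0 ℤ.* g) ℤ.+ + 0) ≡ + 1 ℤ.* g
        lem = solveℤ-∀
val-suc idn n g = trans (lem (+ n) g) (cong (ℤ._* g) (sym (ℤ.pos-+ 1 n)))
  where lem : ∀ n g → + 1 ℤ.* (n ℤ.* g) ℤ.+ (+ 1 ℤ.* (+ 1 ℤ.* g) ℤ.+ + 0) ≡ (+ 1 ℤ.+ n) ℤ.* g
        lem = solveℤ-∀
val-suc two n g = trans (lem (+ (2 ^ n)) g) (cong (ℤ._* g) (sym (ℤ.pos-* 2 (2 ^ n))))
  where lem : ∀ n g → + 2 ℤ.* (n ℤ.* g) ℤ.+ (+ 0 ℤ.* (+ 0 ℤ.* g) ℤ.+ + 0) ≡ (+ 2 ℤ.* n) ℤ.* g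
        lem = solveℤ-∀

out₀-val : ∀ φ → out₀ φ ≡ val φ 0
out₀-val one = refl
out₀-val idn = refl
out₀-val two = refl

block-run : ∀ {k} e φ (A : Aut k) τ p n w u →
  let w′ = replicate n x ++ (letterᵉ e ∷ w)
      g = lookup (run A p w (Vec.tail (Vec.tail u))) τ
  in
  run (block e φ A τ) p w′ u ≡ val φ n ℤ.* g ∷ out₁ φ ℤ.* g ∷ run A p w′ (Vec.tail (Vec.tail u))
block-run e φ A τ p zero w u with run-∷∷ (row₀ e φ τ) (row₁ e φ τ) A p w u
... | a , b , ih rewrite ih
      | row-letter e (con (self φ) ∷ con (link φ) ∷ zeros) (con (+ 0) ∷ con (+ 0) ∷ edge τ (con (out₀ φ)))
      | row-letter e (con (+ 1) ∷ zeros) (con (+ 0) ∷ edge τ (con (out₁ φ))) =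
  cong₂ (λ a b → a ∷ b ∷ act A p (letterᵉ e) v)
    (trans (dot-00 p (edge τ (con (out₀ φ))) a b v) (trans (dot-edge p τ (con (out₀ φ)) v) (cong (ℤ._* lookup v τ) (out₀-val φ))))
    (trans (cong (ℤ._+ dot p (edge τ (con (out₁ φ))) v) (ℤ.*-zeroˡ b)) (trans (ℤ.+-identityˡ _) (dot-edge p τ (con (out₁ φ)) v)))
  where v = run A p w (Vec.tail (Vec.tail u))
block-run e φ A τ p (suc n) w u = trans (cong (act (block e φ A τ) p x) (block-run e φ A τ p n w u))
  (cong₂ (λ a b → a ∷ b ∷ act A p x v)
    (trans (cong (λ s → self φ ℤ.* (val φ n ℤ.* g) ℤ.+ (link φ ℤ.* (out₁ φ ℤ.* g) ℤ.+ s)) (dot-zeros p v)) (val-suc φ n g))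
    (trans (cong (ℤ._+_ (+ 1 ℤ.* (out₁ φ ℤ.* g))) (dot-zeros p v)) (trans (ℤ.+-identityʳ _) (ℤ.*-identityˡ _))))
  where
  v = run A p (replicate n x ++ (letterᵉ e ∷ w)) (Vec.tail (Vec.tail u))
  g = lookup (run A p w (Vec.tail (Vec.tail u))) τ

twice : ℕ → ℕ
twice zero = 0
twice (suc r) = suc (suc (twice r))

body : ∀ {r} → Vec ℕ r → ℕ → List Δ
body ns m = blocks ns ++ (replicate m x ++ (z₂ ∷ []))

mono : ∀ {r} → Vec Fac r → Fac → Vec ℕ r → ℕ → ℤ
mono [] f [] m = val f m
mono (φ ∷ φs) f (n ∷ ns) m = val φ n ℤ.* mono φs f ns m

-- Each closing letter hands over to the first state of the chain for the remaining exponents, so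
-- the factors multiply; the last block hands over to `τ`.
chain : ∀ {r k} → Vec Fac r → Fac → Aut k → Fin k → Aut (suc (suc (twice r + k)))
chain [] f A τ = block last f A τ
chain (φ ∷ φs) f A τ = block inner φ (chain φs f A τ) fzero

low : ∀ r {k} → Vec ℤ (suc (suc (twice r + k))) → Vec ℤ k
low zero u = Vec.tail (Vec.tail u)
low (suc r) u = low r (Vec.tail (Vec.tail u))

up : ∀ r {k} → Fin k → Fin (suc (suc (twice r + k)))
up zero i = fsuc (fsuc i)
up (suc r) i = fsuc (fsuc (up r i))

block-low : ∀ {k} e φ (A : Aut k) τ p w u →
  Vec.tail (Vec.tail (run (block e φ A τ) p w u)) ≡ run A p w (Vec.tail (Vec.tail u))
block-low e φ A τ p w u = cong (λ v → Vec.tail (Vec.tail v)) (proj₂ (proj₂ (run-∷∷ _ _ A p w u)))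

chain-low : ∀ {r k} (φs : Vec Fac r) f (A : Aut k) τ p w u → low r (run (chain φs f A τ) p w u) ≡ run A p w (low r u)
chain-low [] f A τ p w u = block-low last f A τ p w u
chain-low {suc r} (φ ∷ φs) f A τ p w u = trans (cong (low r) (block-low inner φ (chain φs f A τ) fzero p w u))
  (chain-low φs f A τ p w (Vec.tail (Vec.tail u)))

blocks-++ : ∀ n {r} (ns : Vec ℕ r) w → blocks (n ∷ ns) ++ w ≡ replicate n x ++ (y ∷ (blocks ns ++ w))
blocks-++ zero ns w = refl
blocks-++ (suc n) ns w = cong (x ∷_) (blocks-++ n ns w)

chain-run : ∀ {r k} (φs : Vec Fac r) f (A : Aut k) τ p ns m u →
  lookup (run (chain φs f A τ) p (body ns m) u) fzero ≡ mono φs f ns m ℤ.* lookup (low r u) τ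
chain-run [] f A τ p [] m u rewrite block-run last f A τ p m [] u = refl
chain-run {suc r} (φ ∷ φs) f A τ p (n ∷ ns) m u
  rewrite blocks-++ n ns (replicate m x ++ (z₂ ∷ []))
        | block-run inner φ (chain φs f A τ) fzero p n (body ns m) u
        | chain-run φs f A τ p ns m (Vec.tail (Vec.tail u)) = sym (ℤ.*-assoc (val φ n) _ _)

pad : ∀ {k} r → Ent → Vec Ent k → Vec Ent (suc (suc (twice r + k)))
pad zero c α = c ∷ con (+ 0) ∷ α
pad (suc r) c α = c ∷ con (+ 0) ∷ pad r (con (+ 0)) α

dot-pad : ∀ {k} p r c (α : Vec Ent k) v → dot p (pad r c α) v ≡ ent p c ℤ.* lookup v fzero ℤ.+ dot p α (low r v)
dot-pad p zero c α (a ∷ b ∷ v) = cong (ℤ._+_ (ent p c ℤ.* a)) (trans (cong (ℤ._+ dot p α v) (ℤ.*-zeroˡ b)) (ℤ.+-identityˡ _))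
dot-pad p (suc r) c α (a ∷ b ∷ v) = cong (ℤ._+_ (ent p c ℤ.* a))
  (trans (cong (λ s → + 0 ℤ.* b ℤ.+ s) (dot-pad p r (con (+ 0)) α v)) (lem b (lookup v fzero) (dot p α (low r v))))
  where lem : ∀ b c s → + 0 ℤ.* b ℤ.+ (+ 0 ℤ.* c ℤ.+ s) ≡ s
        lem = solveℤ-∀

lookup-low : ∀ r {k} (u : Vec ℤ (suc (suc (twice r + k)))) i → lookup (low r u) i ≡ lookup u (up r i)
lookup-low zero (a ∷ b ∷ u) i = refl
lookup-low (suc r) (a ∷ b ∷ u) i = lookup-low r u i

low-unit : ∀ r {k} (i : Fin k) → low r (unit (up r i)) ≡ unit i
low-unit zero i = refl
low-unit (suc r) i = low-unit r i

-- Several polynomials in one automaton.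

0⃗ : ∀ {k} → Vec ℤ k
0⃗ = Vec.replicate _ (+ 0)

low-0⃗ : ∀ r {k} → low r (0⃗ {suc (suc (twice r + k))}) ≡ 0⃗
low-0⃗ zero = refl
low-0⃗ (suc r) = low-0⃗ r

-- Since every word begins with `z₁`, the rows of its matrix that belong to the automaton then carry
-- no information, and only the row added for the initial state matters.
Quiet : ∀ {k} → Aut k → Set
Quiet A = ∀ p v v′ → act A p z₁ v ≡ act A p z₁ v′

quiet-∷ : ∀ {k} {r} {A : Aut k} → r z₁ ≡ zeros → Quiet A → Quiet (r ∷ᵃ A)
quiet-∷ e q p (a ∷ v) (a′ ∷ v′) rewrite e = cong₂ _∷_ (trans (dot-zeros p (a ∷ v)) (sym (dot-zeros p (a′ ∷ v′)))) (q p v v′)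

quiet-chain : ∀ {r k} (φs : Vec Fac r) f {A : Aut k} {τ} → Quiet A → Quiet (chain φs f A τ)
quiet-chain [] f q = quiet-∷ refl (quiet-∷ refl q)
quiet-chain (φ ∷ φs) f q = quiet-∷ refl (quiet-∷ refl (quiet-chain φs f q))

record Net : Set where
  field
    {states} : ℕ
    aut    : Aut states
    α      : Vec Ent states
    quiet  : Quiet aut

  weight : ℕ → List Δ → Vec ℤ states → ℤ
  weight p w u = dot p α (run aut p w u)

open Net

-- For a fixed word the weight is linear in the final vector `u`. The new polynomial is the
-- coefficient at a fresh coordinate `τ`, and `lower` and `raise` keep the old coordinates apart
-- from it, so that unit vectors recover each polynomial separately.
record Ext (N : Net) {r} (F : ℕ → Vec ℕ r → ℕ → ℤ) : Set where
  field
    net   : Net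
    τ     : Fin (states net)
    lower : Vec ℤ (states net) → Vec ℤ (states N)
    raise : Fin (states N) → Fin (states net)
    spec  : ∀ p ns m u → weight net p (body ns m) u ≡ F p ns m ℤ.* lookup u τ ℤ.+ weight N p (body ns m) (lower u)
    lower-raise : ∀ i → lower (unit (raise i)) ≡ unit i
    raise-τ     : ∀ i → lookup (unit (raise i)) τ ≡ + 0
    lower-τ     : lower (unit τ) ≡ 0⃗
    lower-0⃗     : lower 0⃗ ≡ 0⃗

open Ext

Poly : ℕ → Set
Poly r = List (Ent × Vec Fac r × Fac)

value : ∀ {r} → Poly r → ℕ → Vec ℕ r → ℕ → ℤ
value [] p ns m = + 0
value ((c , φs , f) ∷ P) p ns m = value P p ns m ℤ.+ ent p c ℤ.* mono φs f ns m

extend : ∀ {r} N (P : Poly r) → Ext N (value P)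
-- The zero polynomial contributes only `τ`, with zero rows. The chains of the monomials enter it at
-- `z₂`, the last letter, where its coordinate is still that of `u`.
extend N [] = record
  { net = record { aut = (λ _ → zeros) ∷ᵃ aut N ; α = con (+ 0) ∷ α N ; quiet = quiet-∷ refl (quiet N) }
  ; τ = fzero ; lower = Vec.tail ; raise = fsuc
  ; spec = λ p ns m u → trans (cong (dot p (con (+ 0) ∷ α N)) (run-∷ (λ _ → zeros) (aut N) p (body ns m) u))
      (cong (ℤ._+ weight N p (body ns m) (Vec.tail u))
        (trans (ℤ.*-zeroˡ (lookup (run ((λ _ → zeros) ∷ᵃ aut N) p (body ns m) u) fzero)) (sym (ℤ.*-zeroˡ (lookup u fzero)))))
  ; lower-raise = λ _ → refl ; raise-τ = λ _ → refl ; lower-τ = refl ; lower-0⃗ = refl }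
extend {r} N ((c , φs , f) ∷ P) = record
  { net = record { aut = chain φs f (aut E.net) E.τ ; α = pad r c (α E.net) ; quiet = quiet-chain φs f (quiet E.net) }
  ; τ = up r E.τ ; lower = λ u → E.lower (low r u) ; raise = λ i → up r (E.raise i)
  ; spec = λ p ns m u → begin
      dot p (pad r c (α E.net)) (run A′ p (body ns m) u)
        ≡⟨ dot-pad p r c (α E.net) _ ⟩
      ent p c ℤ.* lookup (run A′ p (body ns m) u) fzero ℤ.+ dot p (α E.net) (low r (run A′ p (body ns m) u))
        ≡⟨ cong₂ (λ a v → ent p c ℤ.* a ℤ.+ dot p (α E.net) v)
             (chain-run φs f (aut E.net) E.τ p ns m u) (chain-low φs f (aut E.net) E.τ p (body ns m) u) ⟩
      ent p c ℤ.* (mono φs f ns m ℤ.* lookup (low r u) E.τ) ℤ.+ weight E.net p (body ns m) (low r u)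
        ≡⟨ cong (ℤ._+_ (ent p c ℤ.* (mono φs f ns m ℤ.* lookup (low r u) E.τ))) (E.spec p ns m (low r u)) ⟩
      ent p c ℤ.* (mono φs f ns m ℤ.* lookup (low r u) E.τ) ℤ.+ (value P p ns m ℤ.* lookup (low r u) E.τ ℤ.+ weight N p (body ns m) (E.lower (low r u)))
        ≡⟨ lem (ent p c) (mono φs f ns m) (lookup (low r u) E.τ) (value P p ns m) _ ⟩
      (value P p ns m ℤ.+ ent p c ℤ.* mono φs f ns m) ℤ.* lookup (low r u) E.τ ℤ.+ weight N p (body ns m) (E.lower (low r u))
        ≡⟨ cong (λ a → (value P p ns m ℤ.+ ent p c ℤ.* mono φs f ns m) ℤ.* a ℤ.+ weight N p (body ns m) (E.lower (low r u)))
             (lookup-low r u E.τ) ⟩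
      (value P p ns m ℤ.+ ent p c ℤ.* mono φs f ns m) ℤ.* lookup u (up r E.τ) ℤ.+ weight N p (body ns m) (E.lower (low r u)) ∎
  ; lower-raise = λ i → trans (cong E.lower (low-unit r (E.raise i))) (E.lower-raise i)
  ; raise-τ = λ i → trans (sym (lookup-low r (unit (up r (E.raise i))) E.τ)) (trans (cong (λ v → lookup v E.τ) (low-unit r (E.raise i))) (E.raise-τ i))
  ; lower-τ = trans (cong E.lower (low-unit r E.τ)) E.lower-τ
  ; lower-0⃗ = trans (cong E.lower (low-0⃗ r)) E.lower-0⃗ }
  where
  open ≡-Reasoning
  module E = Ext (extend N P)
  A′ = chain φs f (aut E.net) E.τ
  lem : ∀ c m a v w → c ℤ.* (m ℤ.* a) ℤ.+ (v ℤ.* a ℤ.+ w) ≡ (v ℤ.+ c ℤ.* m) ℤ.* a ℤ.+ w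
  lem = solveℤ-∀

build : ∀ {r} → List (Poly r) → Net
build [] = record { aut = [] ; α = [] ; quiet = λ { p [] [] → refl } }
build (P ∷ Ps) = net (extend (build Ps) P)

weight-0⃗ : ∀ {r} (Ps : List (Poly r)) p (ns : Vec ℕ r) m → weight (build Ps) p (body ns m) 0⃗ ≡ + 0
weight-0⃗ {r} [] p ns m with run [] p (body ns m) []
... | [] = refl
weight-0⃗ (P ∷ Ps) p ns m = trans (E.spec p ns m 0⃗)
  (trans (cong₂ (λ a v → value P p ns m ℤ.* a ℤ.+ weight (build Ps) p (body ns m) v) (lookup-replicate E.τ (+ 0)) E.lower-0⃗)
    (trans (cong (ℤ._+_ (value P p ns m ℤ.* + 0)) (weight-0⃗ Ps p ns m)) (trans (ℤ.+-identityʳ _) (ℤ.*-zeroʳ (value P p ns m)))))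
  where module E = Ext (extend (build Ps) P)

module _ {r : ℕ} (p : ℕ) (ns ns′ : Vec ℕ r) (m m′ : ℕ) where

  Agree : Poly r → Set
  Agree P = value P p ns m ≡ value P p ns′ m′

  weight-agree : ∀ Ps → All Agree Ps → ∀ u → weight (build Ps) p (body ns m) u ≡ weight (build Ps) p (body ns′ m′) u
  weight-agree [] [] u with run [] p (body ns m) u | run [] p (body ns′ m′) u
  ... | [] | [] = refl
  weight-agree (P ∷ Ps) (h ∷ hs) u = trans (E.spec p ns m u)
    (trans (cong₂ (λ a b → a ℤ.* lookup u E.τ ℤ.+ b) h (weight-agree Ps hs (E.lower u))) (sym (E.spec p ns′ m′ u)))
    where module E = Ext (extend (build Ps) P)

  agree-weight : ∀ Ps → (∀ i → weight (build Ps) p (body ns m) (unit i) ≡ weight (build Ps) p (body ns′ m′) (unit i)) → All Agree Ps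
  agree-weight [] h = []
  agree-weight (P ∷ Ps) h =
    trans (sym (at-τ ns m)) (trans (h E.τ) (at-τ ns′ m′)) ∷
    agree-weight Ps (λ i → trans (sym (at-raise ns m i)) (trans (h (E.raise i)) (at-raise ns′ m′ i)))
    where
    module E = Ext (extend (build Ps) P)
    at-τ : ∀ ns m → weight E.net p (body ns m) (unit E.τ) ≡ value P p ns m
    at-τ ns m = trans (E.spec p ns m (unit E.τ))
      (trans (cong₂ (λ a v → value P p ns m ℤ.* a ℤ.+ weight (build Ps) p (body ns m) v) (lookup-unit E.τ) E.lower-τ)
        (trans (cong (ℤ._+_ (value P p ns m ℤ.* + 1)) (weight-0⃗ Ps p ns m)) (trans (ℤ.+-identityʳ _) (ℤ.*-identityʳ _))))
    at-raise : ∀ ns m i → weight E.net p (body ns m) (unit (E.raise i)) ≡ weight (build Ps) p (body ns m) (unit i)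
    at-raise ns m i = trans (E.spec p ns m (unit (E.raise i)))
      (trans (cong₂ (λ a v → value P p ns m ℤ.* a ℤ.+ weight (build Ps) p (body ns m) v) (E.raise-τ i) (E.lower-raise i))
        (trans (cong (ℤ._+ weight (build Ps) p (body ns m) (unit i)) (ℤ.*-zeroʳ (value P p ns m))) (ℤ.+-identityˡ _)))

-- Equality of images and agreement of polynomials.

initial : ∀ {k} → Vec Ent k → Δ → Vec Ent (suc k)
initial α z₁ = con (+ 0) ∷ α
initial α _ = zeros

dimension : ∀ {r} → List (Poly r) → ℕ
dimension Ps = suc (states (build Ps))

automaton : ∀ {r} (Ps : List (Poly r)) → Aut (dimension Ps)
automaton Ps = initial (α (build Ps)) ∷ᵃ aut (build Ps)

run-z₁ : ∀ {r} (Ps : List (Poly r)) p w u → let N = build Ps in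
  run (automaton Ps) p (z₁ ∷ w) u ≡ weight N p w (Vec.tail u) ∷ act (aut N) p z₁ (run (aut N) p w (Vec.tail u))
run-z₁ Ps p w u = trans (cong (act (automaton Ps) p z₁) (run-∷ _ (aut (build Ps)) p w u))
  (cong (_∷ act (aut (build Ps)) p z₁ (run (aut (build Ps)) p w (Vec.tail u)))
    (trans (cong (ℤ._+ weight (build Ps) p w (Vec.tail u)) (ℤ.*-zeroˡ (lookup (run (automaton Ps) p w u) fzero))) (ℤ.+-identityˡ _)))

lookup-ext : ∀ {A : Set} {k} {u v : Vec A k} → (∀ i → lookup u i ≡ lookup v i) → u ≡ v
lookup-ext {u = u} {v} h = trans (sym (tabulate∘lookup u)) (trans (tabulate-cong h) (tabulate∘lookup v))

entry-ext : ∀ {k} {M N : Mat k} → (∀ i j → entry M i j ≡ entry N i j) → M ≡ N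
entry-ext h = lookup-ext (λ i → lookup-ext (h i))

module _ {r : ℕ} (Ps : List (Poly r)) (p : ℕ) (ns ns′ : Vec ℕ r) (m m′ : ℕ) where
  private
    μ = morphism (automaton Ps) p
    N = build Ps

  apply-agree : All (Agree p ns ns′ m m′) Ps → apply μ (z₁ ∷ body ns m) ≡ apply μ (z₁ ∷ body ns′ m′)
  apply-agree h = entry-ext λ i j → begin
    entry (apply μ (z₁ ∷ body ns m)) i j                        ≡⟨ entry-apply (automaton Ps) p (z₁ ∷ body ns m) i j ⟩
    lookup (run (automaton Ps) p (z₁ ∷ body ns m) (unit j)) i   ≡⟨ cong (λ v → lookup v i) (same (unit j)) ⟩
    lookup (run (automaton Ps) p (z₁ ∷ body ns′ m′) (unit j)) i ≡⟨ entry-apply (automaton Ps) p (z₁ ∷ body ns′ m′) i j ⟨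
    entry (apply μ (z₁ ∷ body ns′ m′)) i j ∎
    where
    open ≡-Reasoning
    same : ∀ u → run (automaton Ps) p (z₁ ∷ body ns m) u ≡ run (automaton Ps) p (z₁ ∷ body ns′ m′) u
    same u = trans (run-z₁ Ps p (body ns m) u)
      (trans (cong₂ _∷_ (weight-agree p ns ns′ m m′ Ps h (Vec.tail u)) (quiet N p _ _)) (sym (run-z₁ Ps p (body ns′ m′) u)))

  -- The first row of the matrix contains the weights at all unit vectors.
  agree-apply : apply μ (z₁ ∷ body ns m) ≡ apply μ (z₁ ∷ body ns′ m′) → All (Agree p ns ns′ m m′) Ps
  agree-apply e = agree-weight p ns ns′ m m′ Ps λ i → trans (sym (first ns m i)) (trans (cong (λ M → entry M fzero (fsuc i)) e) (first ns′ m′ i))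
    where
    first : ∀ ns m i → entry (apply μ (z₁ ∷ body ns m)) fzero (fsuc i) ≡ weight N p (body ns m) (unit i)
    first ns m i = trans (entry-apply (automaton Ps) p (z₁ ∷ body ns m) fzero (fsuc i))
      (cong (λ v → lookup v fzero) (run-z₁ Ps p (body ns m) (unit (fsuc i))))

-- Equations as polynomials in the exponents.

ones : ∀ {r} → Vec Fac r
ones = Vec.replicate _ one

single : ∀ {r} → Fin r → Fac → Vec Fac r
single i φ = ones [ i ]≔ φ

mono-ones : ∀ {r} f (ns : Vec ℕ r) m → mono ones f ns m ≡ val f m
mono-ones f [] m = refl
mono-ones f (n ∷ ns) m = trans (ℤ.*-identityˡ _) (mono-ones f ns m)

mono-update : ∀ {r} (φs : Vec Fac r) i φ f ns m → lookup φs i ≡ one →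
  mono (φs [ i ]≔ φ) f ns m ≡ val φ (lookup ns i) ℤ.* mono φs f ns m
mono-update (.one ∷ φs) fzero φ f (n ∷ ns) m refl = cong (ℤ._*_ (val φ n)) (sym (ℤ.*-identityˡ _))
mono-update (ψ ∷ φs) (fsuc i) φ f (n ∷ ns) m e =
  trans (cong (ℤ._*_ (val ψ n)) (mono-update φs i φ f ns m e)) (lem (val ψ n) (val φ (lookup ns i)) (mono φs f ns m))
  where lem : ∀ a b c → a ℤ.* (b ℤ.* c) ≡ b ℤ.* (a ℤ.* c)
        lem = solveℤ-∀

mono-single : ∀ {r} (i : Fin r) φ f ns m → mono (single i φ) f ns m ≡ val φ (lookup ns i) ℤ.* val f m
mono-single i φ f ns m = trans (mono-update ones i φ f ns m (lookup-replicate i one)) (cong (ℤ._*_ (val φ (lookup ns i))) (mono-ones f ns m))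

data Equation (N : ℕ) : Set where
  atom  : Atom N → Equation N
  input : Fin N → Equation N

lhsᵉ rhsᵉ : ∀ {N} → ℕ → Equation N → Vec ℕ N → ℕ
lhsᵉ p (atom (eq i j)) w = lookup w i
lhsᵉ p (atom (is i c)) w = lookup w i
lhsᵉ p (atom (sum i j k _)) w = lookup w i + lookup w j
lhsᵉ p (atom (prod i j k _)) w = lookup w i * lookup w j
lhsᵉ p (atom (pow i j)) w = 2 ^ lookup w i
lhsᵉ p (input i) w = p
rhsᵉ p (atom (eq i j)) w = lookup w j
rhsᵉ p (atom (is i c)) w = c
rhsᵉ p (atom (sum i j k _)) w = lookup w k
rhsᵉ p (atom (prod i j k _)) w = lookup w k
rhsᵉ p (atom (pow i j)) w = lookup w j
rhsᵉ p (input i) w = lookup w i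

pos neg : Ent
pos = con (+ 1)
neg = con (ℤ.- + 1)

-- Every term has the factor `idn` at the last exponent, which yields the common factor `s`.
-- Constants and the parameter go into coefficients.
constraint : ∀ {N} → Equation N → Poly N
constraint (atom (eq i j)) = (neg , single j idn , idn) ∷ (pos , single i idn , idn) ∷ []
constraint (atom (is i c)) = (con (ℤ.- + c) , ones , idn) ∷ (pos , single i idn , idn) ∷ []
constraint (atom (sum i j k _)) =
  (neg , single k idn , idn) ∷ (pos , single j idn , idn) ∷ (pos , single i idn , idn) ∷ []
constraint (atom (prod i j k _)) = (neg , single k idn , idn) ∷ (pos , single i idn [ j ]≔ idn , idn) ∷ []
constraint (atom (pow i j)) = (neg , single j idn , idn) ∷ (pos , single i two , idn) ∷ []
constraint (input i) = (neg , single i idn , idn) ∷ (par , ones , idn) ∷ []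

two-terms : ∀ a b s {u v} → u ≡ a ℤ.* s → v ≡ b ℤ.* s →
  (+ 0 ℤ.+ + 1 ℤ.* u) ℤ.+ (ℤ.- + 1) ℤ.* v ≡ (a ℤ.- b) ℤ.* s
two-terms a b s refl refl = lem a b s
  where lem : ∀ a b s → (+ 0 ℤ.+ + 1 ℤ.* (a ℤ.* s)) ℤ.+ (ℤ.- + 1) ℤ.* (b ℤ.* s) ≡ (a ℤ.- b) ℤ.* s
        lem = solveℤ-∀

constraint-value : ∀ {N} p (q : Equation N) w s → value (constraint q) p w s ≡ (+ lhsᵉ p q w ℤ.- + rhsᵉ p q w) ℤ.* + s
constraint-value p (atom (eq i j)) w s = two-terms (+ lookup w i) (+ lookup w j) (+ s) (mono-single i idn idn w s) (mono-single j idn idn w s)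
constraint-value p (atom (is i c)) w s =
  trans (cong₂ (λ u v → (+ 0 ℤ.+ + 1 ℤ.* u) ℤ.+ (ℤ.- + c) ℤ.* v) (mono-single i idn idn w s) (mono-ones idn w s)) (lem (+ lookup w i) (+ c) (+ s))
  where lem : ∀ a c s → (+ 0 ℤ.+ + 1 ℤ.* (a ℤ.* s)) ℤ.+ (ℤ.- c) ℤ.* s ≡ (a ℤ.- c) ℤ.* s
        lem = solveℤ-∀
constraint-value p (atom (sum i j k _)) w s =
  trans (cong₂ (λ u v → ((+ 0 ℤ.+ + 1 ℤ.* u) ℤ.+ + 1 ℤ.* v) ℤ.+ (ℤ.- + 1) ℤ.* mono (single k idn) idn w s)
      (mono-single i idn idn w s) (mono-single j idn idn w s))
    (trans (cong (λ u → ((+ 0 ℤ.+ + 1 ℤ.* (+ lookup w i ℤ.* + s)) ℤ.+ + 1 ℤ.* (+ lookup w j ℤ.* + s)) ℤ.+ (ℤ.- + 1) ℤ.* u)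
        (mono-single k idn idn w s))
      (trans (lem (+ lookup w i) (+ lookup w j) (+ lookup w k) (+ s))
        (cong (λ a → (a ℤ.- + lookup w k) ℤ.* + s) (sym (ℤ.pos-+ (lookup w i) (lookup w j))))))
  where lem : ∀ a b c s → ((+ 0 ℤ.+ + 1 ℤ.* (a ℤ.* s)) ℤ.+ + 1 ℤ.* (b ℤ.* s)) ℤ.+ (ℤ.- + 1) ℤ.* (c ℤ.* s) ≡ ((a ℤ.+ b) ℤ.- c) ℤ.* s
        lem = solveℤ-∀
constraint-value p (atom (prod i j k i≢j)) w s = two-terms (+ (lookup w i * lookup w j)) (+ lookup w k) (+ s)
  -- As `j` differs from `i`, its factor is still `one` and can be replaced.
  (trans (mono-update (single i idn) j idn idn w s (trans (lookup∘update′ (i≢j ∘ sym) ones idn) (lookup-replicate j one)))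
    (trans (cong (ℤ._*_ (+ lookup w j)) (mono-single i idn idn w s))
      (trans (lem (+ lookup w i) (+ lookup w j) (+ s)) (cong (ℤ._* + s) (sym (ℤ.pos-* (lookup w i) (lookup w j)))))))
  (mono-single k idn idn w s)
  where lem : ∀ a b s → b ℤ.* (a ℤ.* s) ≡ (a ℤ.* b) ℤ.* s
        lem = solveℤ-∀
constraint-value p (atom (pow i j)) w s = two-terms (+ (2 ^ lookup w i)) (+ lookup w j) (+ s) (mono-single i two idn w s) (mono-single j idn idn w s)
constraint-value p (input i) w s =
  trans (cong₂ (λ u v → (+ 0 ℤ.+ + p ℤ.* u) ℤ.+ (ℤ.- + 1) ℤ.* v) (mono-ones idn w s) (mono-single i idn idn w s)) (lem (+ p) (+ lookup w i) (+ s))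
  where lem : ∀ p a s → (+ 0 ℤ.+ p ℤ.* s) ℤ.+ (ℤ.- + 1) ℤ.* (a ℤ.* s) ≡ (p ℤ.- a) ℤ.* s
        lem = solveℤ-∀

-- The last factor is `one`, so these values pin down the unknowns and do not see `s`.
coordinate : ∀ {N} → Fin N → Poly N
coordinate i = (pos , single i idn , one) ∷ []

coordinate-value : ∀ {N} p (i : Fin N) w s → value (coordinate i) p w s ≡ + lookup w i
coordinate-value p i w s = trans (cong (λ u → + 0 ℤ.+ + 1 ℤ.* u) (mono-single i idn one w s)) (lem (+ lookup w i))
  where lem : ∀ a → + 0 ℤ.+ + 1 ℤ.* (a ℤ.* + 1) ≡ a
        lem = solveℤ-∀

-- Solvability against injectivity.

module Encode (S : Sys 1) where
  open Sys S using () renaming (size to N; free to σ; atoms to as)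

  equations : List (Equation N)
  equations = input (Vec.head σ) ∷ List.map atom as

  polynomials : List (Poly N)
  polynomials = List.tabulate coordinate ++ List.map constraint equations

  Solves : ℕ → Vec ℕ N → Set
  Solves p w = All (λ q → lhsᵉ p q w ≡ rhsᵉ p q w) equations

  holds : ∀ p w (a : Atom N) → lhsᵉ p (atom a) w ≡ rhsᵉ p (atom a) w → Holds w a
  holds p w (eq i j) h = h
  holds p w (is i c) h = h
  holds p w (sum i j k _) h = h
  holds p w (prod i j k _) h = h
  holds p w (pow i j) h = h

  holds⁻ : ∀ p w (a : Atom N) → Holds w a → lhsᵉ p (atom a) w ≡ rhsᵉ p (atom a) w
  holds⁻ p w (eq i j) h = h
  holds⁻ p w (is i c) h = h
  holds⁻ p w (sum i j k _) h = h
  holds⁻ p w (prod i j k _) h = h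
  holds⁻ p w (pow i j) h = h

  look₁ : ∀ {M} (w : Vec ℕ M) (τ : Vec (Fin M) 1) → look w τ ≡ (lookup w (Vec.head τ) , tt)
  look₁ w (i ∷ []) = refl

  solves⇒sat : ∀ p w → Solves p w → Sat S (p , tt)
  solves⇒sat p w (h ∷ hs) = w , trans (look₁ w σ) (cong (_, tt) (sym h)) , All.map (λ {a} → holds p w a) (All.map⁻ hs)

  sat⇒solves : ∀ p → Sat S (p , tt) → Σ (Vec ℕ N) (Solves p)
  sat⇒solves p (w , e , hs) = w , sym (cong proj₁ (trans (sym (look₁ w σ)) e)) ∷ All.map⁺ (All.map (λ {a} → holds⁻ p w a) hs)

  -- The `t ∸ 1` blocks closed by `y` are the `N` unknowns; the exponent before `z₂` is `s`.
  t : ℕ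
  t = suc N

  μ : ∀ p → Morphism (dimension polynomials)
  μ = morphism (automaton polynomials)

  -- A solution w makes the last exponent s invisible, since it only occurs in s * (lhs - rhs).
  solves⇒agree : ∀ p w → Solves p w → All (Agree p w w 0 1) polynomials
  solves⇒agree p w hs = All.++⁺
    (All.tabulate⁺ λ i → trans (coordinate-value p i w 0) (sym (coordinate-value p i w 1)))
    (All.map⁺ (All.map (λ {q} → agree q) hs))
    where
    agree : ∀ q → lhsᵉ p q w ≡ rhsᵉ p q w → Agree p w w 0 1 (constraint q)
    agree q h = trans (constraint-value p q w 0) (trans (cong (ℤ._* + 0) z) (trans (cong (ℤ._* + 1) (sym z)) (sym (constraint-value p q w 1))))
      where z : + lhsᵉ p q w ℤ.- + rhsᵉ p q w ≡ + 0
            z = trans (cong (λ a → + a ℤ.- + rhsᵉ p q w) h) (ℤ.+-inverseʳ (+ rhsᵉ p q w))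

  agree⇒≡ : ∀ p w w′ s s′ → All (Agree p w w′ s s′) polynomials → w ≡ w′
  agree⇒≡ p w w′ s s′ agree = lookup-ext λ i → ℤ.+-injective (trans (sym (coordinate-value p i w s))
    (trans (All.tabulate⁻ {f = coordinate} (All.++⁻ˡ (List.tabulate coordinate) agree) i) (coordinate-value p i w′ s′)))

  agree⇒solves : ∀ p w s s′ → s ≢ s′ → All (Agree p w w s s′) polynomials → Solves p w
  agree⇒solves p w s s′ s≢s′ agree = All.map (λ {q} → solve q) (All.map⁻ (All.++⁻ʳ (List.tabulate coordinate) agree))
    where
    distrib : ∀ a s s′ → a ℤ.* (s ℤ.- s′) ≡ a ℤ.* s ℤ.- a ℤ.* s′
    distrib = solveℤ-∀
    solve : ∀ q → Agree p w w s s′ (constraint q) → lhsᵉ p q w ≡ rhsᵉ p q w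
    solve q h = cases (ℤ.i*j≡0⇒i≡0∨j≡0 d {+ s ℤ.- + s′}
        (trans (distrib d (+ s) (+ s′)) (ℤ.i≡j⇒i-j≡0 (trans (sym (constraint-value p q w s)) (trans h (constraint-value p q w s′))))))
      where
      d = + lhsᵉ p q w ℤ.- + rhsᵉ p q w
      cases : d ≡ + 0 ⊎ + s ℤ.- + s′ ≡ + 0 → lhsᵉ p q w ≡ rhsᵉ p q w
      cases (inj₁ z) = ℤ.+-injective (ℤ.i-j≡0⇒i≡j _ _ z)
      cases (inj₂ z) = ⊥-elim (s≢s′ (ℤ.+-injective (ℤ.i-j≡0⇒i≡j _ _ z)))

  not-injective : ∀ p → Sat S (p , tt) → ¬ InjectiveOnK t (μ p)
  not-injective p sat inj = distinct (++-cancelˡ (blocks w) _ _ (∷-injectiveʳ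
    (inj _ _ (w , 0 , refl) (w , 1 , refl) (apply-agree polynomials p w w 0 1 (solves⇒agree p w hs)))))
    where
    w = proj₁ (sat⇒solves p sat)
    hs = proj₂ (sat⇒solves p sat)
    distinct : z₂ ∷ [] ≢ x ∷ z₂ ∷ []
    distinct ()

  -- Equal images force equal unknowns through the coordinates. Two different exponents `s` would
  -- then make every difference of the two sides vanish, which is a solution.
  injective : ∀ p → ¬ Sat S (p , tt) → InjectiveOnK t (μ p)
  injective p unsat _ _ (w , s , refl) (w′ , s′ , refl) e =
    cong₂ (λ w s → z₁ ∷ body w s) (agree⇒≡ p w w′ s s′ agree) (same (agree⇒≡ p w w′ s s′ agree) agree (s ≟ s′))
    where
    agree = agree-apply polynomials p w w′ s s′ e
    same : ∀ {w′} → w ≡ w′ → All (Agree p w w′ s s′) polynomials → Dec (s ≡ s′) → s ≡ s′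
    same refl agree (yes s≡s′) = s≡s′
    same refl agree (no s≢s′) = ⊥-elim (unsat (solves⇒sat p w (agree⇒solves p w s s′ s≢s′ agree)))

-- Computing the code of the morphism from the parameter.

constantᵖ : ℕ → PR 1
constantᵖ zero = Zf
constantᵖ (suc n) = Cf Sf (constantᵖ n ∷ [])

eval-constant : ∀ n {p} → Eval (constantᵖ n) (p ∷ []) n
eval-constant zero = eZ
eval-constant (suc n) = eC (eval-constant n ∷ []) eS

-- `codeℤ` sends `+ p` to `2 * p`, so this program computes the code of an entry `par`.
doubleᵖ : PR 1
doubleᵖ = Rf Zf (Cf Sf (Cf Sf (Pf (fsuc fzero) ∷ []) ∷ []))

eval-double : ∀ p → Eval doubleᵖ (p ∷ []) (2 * p)
eval-double zero = eR0 eZ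
eval-double (suc p) = subst (Eval doubleᵖ (suc p ∷ [])) (cong suc (sym (+-suc p (p + 0))))
  (eRS (eval-double p) (eC (eC (eP ∷ []) eS ∷ []) eS))

entryᵖ : Ent → PR 1
entryᵖ (con c) = constantᵖ (codeℤ c)
entryᵖ par = doubleᵖ

eval-entry : ∀ c p → Eval (entryᵖ c) (p ∷ []) (codeℤ (ent p c))
eval-entry (con c) p = eval-constant (codeℤ c)
eval-entry par p = eval-double p

eval-tabulate : ∀ {m n} {f : Fin m → PR n} {g : Fin m → ℕ} {as} →
  (∀ i → Eval (f i) as (g i)) → EvalAll (tabulate f) as (tabulate g)
eval-tabulate {zero} h = []
eval-tabulate {suc m} h = h fzero ∷ eval-tabulate (λ i → h (fsuc i))

eval-++ : ∀ {m m′ n} {fs : Vec (PR n) m} {gs : Vec (PR n) m′} {as us vs} →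
  EvalAll fs as us → EvalAll gs as vs → EvalAll (fs Vec.++ gs) as (us Vec.++ vs)
eval-++ [] hs = hs
eval-++ (h ∷ hs) hs′ = h ∷ eval-++ hs hs′

eval-concat : ∀ {l m n} {F : Fin l → Vec (PR n) m} {G : Fin l → Vec ℕ m} {as} →
  (∀ i → EvalAll (F i) as (G i)) → EvalAll (concat (tabulate F)) as (concat (tabulate G))
eval-concat {zero} h = []
eval-concat {suc l} h = eval-++ (h fzero) (eval-concat (λ i → h (fsuc i)))

entries : ∀ {k} → Aut k → Vec (PR 1) (4 * (k * k))
entries A = concat (tabulate λ a → concat (tabulate λ i → tabulate λ j → entryᵖ (entryᵃ A (letter a) i j)))

eval-entries : ∀ {k} (A : Aut k) p → EvalAll (entries A) (p ∷ []) (code (morphism A p))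
eval-entries A p = eval-concat λ a → eval-concat λ i → eval-tabulate λ j →
  subst (λ c → Eval (entryᵖ (entryᵃ A (letter a) i j)) (p ∷ []) (codeℤ c))
    (sym (entry-matrix A p (letter a) i j)) (eval-entry (entryᵃ A (letter a) i j) p)

-- Diagonalisation.

start accept : ℕ → ℕ
-- The stack with the single instruction `p` and the vector with the single component `p` have the
-- same code: the program is run on itself.
start p = pair (pair p 0) (pair p 0)
accept r = pair 0 r

accepted : Dio exp {1} (λ ρ → Star _⟶_ (start (proj₁ ρ)) (accept 1))
accepted = reachable (pairTm (pairTm top (con 0)) (pairTm top (con 0))) (pairTm (con 0) (con 1))

-- The diagonal argument: the program applies the decision procedure to the
-- morphism that is injective iff the program does not output 1 on its own code.
module Diagonal (C : Compiled {1} (λ ρ → Star _⟶_ (start (proj₁ ρ)) (accept 1))) where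
  open Encode (Compiled.system C)

  k : ℕ
  k = dimension polynomials

  module _ (e : PR (4 * (k * k))) (decides : DecidesInjectivity k t e) where
    private
      p : ℕ
      p = ⌜ Cf e (entries (automaton polynomials)) ⌝

    output : ∀ {r} → Eval e (code (μ p)) r → Star _⟶_ (start p) (accept r)
    output d = run-eval (eC (eval-entries (automaton polynomials) p) d) 0

    -- Injectivity would bring the answer 1, hence an accepting run, a solution of the system, and a
    -- failure of injectivity. This makes the second clause of the decision procedure applicable
    -- without excluded middle.
    ¬injective : ¬ InjectiveOnK t (μ p)
    ¬injective inj = not-injective p (Compiled.complete C (p , tt) (output (proj₁ (decides (μ p)) inj))) inj

    -- The answer is 0 by now, and a deterministic run has at most one normal form.
    ¬accepted : ¬ Star _⟶_ (start p) (accept 1)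
    ¬accepted acc = 1≢0 (proj₂ (pair-injective
      (normal-unique acc (output (proj₂ (decides (μ p)) ¬injective)) (stuck-pair 1) (stuck-pair 0))))
      where
      1≢0 : 1 ≢ 0
      1≢0 ()

    contradiction : ⊥
    contradiction = ¬injective (injective p (λ sat → ¬accepted (Compiled.sound C (p , tt) sat)))

  undecidable : Σ ℕ λ k → Σ ℕ λ t → (1 ≤ k) × (1 ≤ t) ×
    ¬ (Σ (PR (4 * (k * k))) λ e → DecidesInjectivity k t e)
  undecidable = k , t , s≤s z≤n , s≤s z≤n , λ (e , decides) → contradiction e decides

theorem2 : Σ ℕ λ k → Σ ℕ λ t → (1 ≤ k) × (1 ≤ t) ×
    ¬ (Σ (PR (4 * (k * k))) λ e → DecidesInjectivity k t e)
theorem2 = Diagonal.undecidable (compile accepted)
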